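{- Fix integers $r\ge 4$ and $k\ge 2$. There is a constant $B>0$, depending only on $r$ and $k$, such that for every real $P\ge 2$ and $C\ge 2$, $$M_{r,k}(P,C)\le \exp\bigl(B(P+\log C)^2\bigr)$$ (in particular $M_{r,k}(P,C)$ exists).
   Context: All graphs are finite and simple; subgraphs need not be induced. $\chi$ is the chromatic number, $e(G)$ the number of edges; the girth of a forest is $\infty$; $\log$ is natural. $M_{r,k}(P,C)$ is the least threshold, if it exists, such that every graph $G$ with $\chi(G)\ge M_{r,k}(P,C)$ and $e(G)\le C\chi(G)^P$ contains a subgraph of girth at least $r$ and chromatic number at least $k$. -}

module Defs where

open import Data.Bool using (Bool; false; T)
open import Data.Empty using (⊥)
open import Data.Fin as Fin using (Fin; inject₁; finToFun; funToFin)
import Data.Fin.Properties as Fin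
import Data.Integer as ℤ
import Data.Integer.Properties as ℤ
open import Data.List using (List; length; filter; cartesianProduct; allFin)
open import Data.Nat as ℕ using (ℕ; zero; suc)
import Data.Nat.Properties as ℕ
open import Data.Product using (Σ; ∃; _×_; _,_; proj₁; proj₂)
open import Data.Rational
  using (ℚ; mkℚ; 0ℚ; 1ℚ; ½; _+_; _*_; _-_; -_; _/_; 1/_; _⊔_; ∣_∣; ↥_; _≤_; _<_;
         toℚᵘ; NonZero; >-nonZero; nonNegative; positive)
import Data.Rational.Properties as ℚ
open import Data.Rational.Solver using (module +-*-Solver)
import Data.Rational.Unnormalised as ℚᵘ
import Data.Rational.Unnormalised.Properties as ℚᵘ
open import Data.Sum using (inj₁; inj₂)
open import Function using (_∘_; id)
open import Function.Definitions using (Injective)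
open import Relation.Binary.Construct.Add.Supremum.NonStrict ℕ._≤_ using (_≤⁺_)
open import Relation.Binary.PropositionalEquality
  using (_≡_; _≢_; _≗_; refl; sym; trans; cong; cong₂; subst; subst₂)
open import Relation.Nullary using (¬_; ¬?; Dec; yes; no; contradiction; map′; T?; _×-dec_; _→-dec_)
open import Relation.Nullary.Construct.Add.Supremum using (_⁺; [_]; ⊤⁺)
open import Relation.Unary using (Decidable)
open +-*-Solver using (solve; _:=_; _:+_; _:*_; _:-_; :-_; con)

IsLeast : (ℕ → Set) → ℕ → Set
IsLeast P m = P m × (∀ j → P j → m ℕ.≤ j)

least : {P : ℕ → Set} → Decidable P → ∃ P → ∃ (IsLeast P)
least {P} P? (m , Pm) = go P P? m Pm
  where
  go : (P : ℕ → Set) → Decidable P → ∀ m → P m → ∃ (IsLeast P)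
  go P P? zero    Pm = zero , Pm , λ _ _ → ℕ.z≤n
  go P P? (suc m) Pm with P? 0
  ... | yes P0 = zero , P0 , λ _ _ → ℕ.z≤n
  ... | no ¬P0 with go (P ∘ suc) (P? ∘ suc) m Pm
  ...   | i , Pi , low = suc i , Pi , λ
            { zero    P0 → contradiction P0 ¬P0
            ; (suc j) Pj → ℕ.s≤s (low j Pj) }

∃-function? : ∀ {m n} {P : (Fin m → Fin n) → Set} →
              (∀ {f g} → f ≗ g → P f → P g) → Decidable P → Dec (∃ P)
∃-function? {m} {n} {P} resp P? = map′
  (λ (i , p) → finToFun i , p)
  (λ (f , p) → funToFin f , resp (sym ∘ Fin.finToFun-funToFin f) p)
  (Fin.any? {n ℕ.^ m} (P? ∘ finToFun))

record Graph : Set where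
  field
    order     : ℕ
    adj       : Fin order → Fin order → Bool
    symmetric : ∀ u v → adj u v ≡ adj v u
    loopless  : ∀ u → adj u u ≡ false

  Vertex : Set
  Vertex = Fin order

  Adj : Vertex → Vertex → Set
  Adj u v = T (adj u v)

  adj? : ∀ u v → Dec (Adj u v)
  adj? u v = T? (adj u v)

open Graph using (order; Vertex)

edges : (G : Graph) → List (Vertex G × Vertex G)
edges G = filter (λ (u , v) → (u Fin.<? v) ×-dec adj? u v)
                 (cartesianProduct (allFin (order G)) (allFin (order G)))
  where open Graph G

e : Graph → ℕ
e G = length (edges G)

-- H is isomorphic to a (not necessarily induced) subgraph of G.
_⊑_ : Graph → Graph → Set
H ⊑ G = Σ (Vertex H → Vertex G) λ f →
  Injective _≡_ _≡_ f × (∀ u v → Graph.Adj H u v → Graph.Adj G (f u) (f v))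

infix 4 _⊑_

IsColouring : (G : Graph) {c : ℕ} → (Vertex G → Fin c) → Set
IsColouring G f = ∀ u v → Graph.Adj G u v → f u ≢ f v

Colourable : Graph → ℕ → Set
Colourable G c = ∃ (IsColouring G {c})

colourable? : ∀ G → Decidable (Colourable G)
colourable? G c = ∃-function?
  (λ f≗g p u v uv gu≡gv → p u v uv (trans (f≗g u) (trans gu≡gv (sym (f≗g v)))))
  (λ f → Fin.all? λ u → Fin.all? λ v →
    Graph.adj? G u v →-dec ¬? (f u Fin.≟ f v))

identity-colouring : ∀ G → Colourable G (order G)
identity-colouring G = id , λ u v uv u≡v →
  subst T (trans (cong (Graph.adj G u) (sym u≡v)) (Graph.loopless G u)) uv

χ : Graph → ℕ
χ G = proj₁ (least (colourable? G) (order G , identity-colouring G))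

-- v₀ v₁ … v_l v₀ is a cycle; its length is l + 1 ≥ 3.
IsCycle : (G : Graph) (l : ℕ) → (Fin (suc l) → Vertex G) → Set
IsCycle G l v =
  2 ℕ.≤ l ×
  Injective _≡_ _≡_ v ×
  (∀ i → Adj (v (inject₁ i)) (v (Fin.suc i))) ×
  Adj (v (Fin.fromℕ l)) (v Fin.zero)
  where open Graph G

HasCycle : Graph → ℕ → Set
HasCycle G zero    = ⊥
HasCycle G (suc l) = ∃ (IsCycle G l)

hasCycle? : ∀ G → Decidable (HasCycle G)
hasCycle? G zero    = no id
hasCycle? G (suc l) = ∃-function? transport λ v →
  (2 ℕ.≤? l) ×-dec
  (map′ (λ inj {x} {y} → inj x y) (λ inj x y → inj {x} {y})
        (Fin.all? λ x → Fin.all? λ y → (v x Fin.≟ v y) →-dec (x Fin.≟ y))) ×-dec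
  (Fin.all? λ i → adj? (v (inject₁ i)) (v (Fin.suc i))) ×-dec
  adj? (v (Fin.fromℕ l)) (v Fin.zero)
  where
  open Graph G
  transport : ∀ {f g} → f ≗ g → IsCycle G l f → IsCycle G l g
  transport f≗g (2≤l , inj , path , close) =
    2≤l ,
    (λ gx≡gy → inj (trans (f≗g _) (trans gx≡gy (sym (f≗g _))))) ,
    (λ i → subst₂ Adj (f≗g _) (f≗g _) (path i)) ,
    subst₂ Adj (f≗g _) (f≗g _) close

cycle-length≤order : ∀ G ℓ → HasCycle G ℓ → ℓ ℕ.≤ order G
cycle-length≤order G (suc l) (v , _ , inj , _) = Fin.injective⇒≤ inj

cyclic? : ∀ G → Dec (∃ (HasCycle G))
cyclic? G = map′
  (λ (i , c) → Fin.toℕ i , c)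
  (λ (ℓ , c) → Fin.fromℕ< (ℕ.s≤s (cycle-length≤order G ℓ c)) ,
               subst (HasCycle G) (sym (Fin.toℕ-fromℕ< _)) c)
  (Fin.any? {suc (order G)} (hasCycle? G ∘ Fin.toℕ))

-- ⊤⁺ = ∞ when G is a forest.
girth : Graph → ℕ ⁺
girth G with cyclic? G
... | yes cycle = [ proj₁ (least (hasCycle? G) cycle) ]
... | no _      = ⊤⁺

fromℕ : ℕ → ℚ
fromℕ n = ℤ.+ n / 1

1/suc : ℕ → ℚ
1/suc n = ℤ.+ 1 / suc n

private
  toℚᵘ-/ : ∀ i d → toℚᵘ (i / suc d) ℚᵘ.≃ ℚᵘ.mkℚᵘ i d
  toℚᵘ-/ i d = ℚ.toℚᵘ-fromℚᵘ (ℚᵘ.mkℚᵘ i d)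

fromℕ-suc : ∀ n → fromℕ (suc n) ≡ 1ℚ + fromℕ n
fromℕ-suc n = ℚ.toℚᵘ-injective (begin
  toℚᵘ (fromℕ (suc n))             ≈⟨ toℚᵘ-/ (ℤ.+ suc n) 0 ⟩
  ℚᵘ.mkℚᵘ (ℤ.+ suc n) 0              ≈⟨ ℚᵘ.*≡* (cong (ℤ._* ℤ.+ 1) (sym (cong (λ z → ℤ.+ 1 ℤ.+ z) (ℤ.*-identityʳ (ℤ.+ n))))) ⟩
  ℚᵘ.mkℚᵘ (ℤ.+ 1) 0 ℚᵘ.+ ℚᵘ.mkℚᵘ (ℤ.+ n) 0 ≈⟨ ℚᵘ.+-congʳ ℚᵘ.1ℚᵘ (ℚᵘ.≃-sym (toℚᵘ-/ (ℤ.+ n) 0)) ⟩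
  toℚᵘ 1ℚ ℚᵘ.+ toℚᵘ (fromℕ n)      ≈⟨ ℚᵘ.≃-sym (ℚ.toℚᵘ-homo-+ 1ℚ (fromℕ n)) ⟩
  toℚᵘ (1ℚ + fromℕ n)              ∎)
  where open ℚᵘ.≃-Reasoning

1/suc-inverse : ∀ n → fromℕ (suc n) * 1/suc n ≡ 1ℚ
1/suc-inverse n = ℚ.toℚᵘ-injective (begin
  toℚᵘ (fromℕ (suc n) * 1/suc n)   ≈⟨ ℚ.toℚᵘ-homo-* (fromℕ (suc n)) (1/suc n) ⟩
  toℚᵘ (fromℕ (suc n)) ℚᵘ.* toℚᵘ (1/suc n)
    ≈⟨ ℚᵘ.*-cong (toℚᵘ-/ (ℤ.+ suc n) 0) (toℚᵘ-/ (ℤ.+ 1) n) ⟩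
  ℚᵘ.mkℚᵘ (ℤ.+ suc n) 0 ℚᵘ.* ℚᵘ.mkℚᵘ (ℤ.+ 1) n
    ≈⟨ ℚᵘ.*≡* (trans (ℤ.*-identityʳ (ℤ.+ suc n ℤ.* ℤ.+ 1)) (trans (ℤ.*-comm (ℤ.+ suc n) (ℤ.+ 1)) (cong (λ z → ℤ.+ 1 ℤ.* ℤ.+ suc z) (sym (ℕ.+-identityʳ n))))) ⟩
  ℚᵘ.1ℚᵘ                           ∎)
  where open ℚᵘ.≃-Reasoning

open ℚ.≤-Reasoning

0≤1 : 0ℚ ≤ 1ℚ
0≤1 = ℚ.nonNegative⁻¹ 1ℚ

0<1 : 0ℚ < 1ℚ
0<1 = ℚ.positive⁻¹ 1ℚ

0<1/suc : ∀ n → 0ℚ < 1/suc n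
0<1/suc n = ℚ.positive⁻¹ (1/suc n) {{ℚ.normalize-pos 1 (suc n)}}

0≤1/suc : ∀ n → 0ℚ ≤ 1/suc n
0≤1/suc n = ℚ.<⇒≤ (0<1/suc n)

0≤fromℕ : ∀ n → 0ℚ ≤ fromℕ n
0≤fromℕ n = ℚ.nonNegative⁻¹ (fromℕ n) {{ℚ.normalize-nonNeg n 1}}

≤-archimedean : ∀ q → q ≤ fromℕ ℤ.∣ ↥ q ∣
≤-archimedean q@(mkℚ i d _) = ℚ.toℚᵘ-cancel-≤ (ℚᵘ.≤-respʳ-≃ (ℚᵘ.≃-sym (toℚᵘ-/ (ℤ.+ ℤ.∣ i ∣) 0))
  (ℚᵘ.*≤* (ℤ.≤-trans (ℤ.≤-reflexive (ℤ.*-identityʳ i)) (bound i))))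
  where
  bound : ∀ i → i ℤ.≤ ℤ.+ ℤ.∣ i ∣ ℤ.* ℤ.+ suc d
  bound (ℤ.+ n)      = ℤ.≤-trans (ℤ.+≤+ (ℕ.m≤m*n n (suc d))) (ℤ.≤-reflexive (ℤ.pos-* n (suc d)))
  bound ℤ.-[1+ n ] = ℤ.-≤+

+-≤ : ∀ {p q r s} → p ≤ q → r ≤ s → p + r ≤ q + s
+-≤ = ℚ.+-mono-≤

*-≤ʳ : ∀ {p q} r → 0ℚ ≤ r → p ≤ q → p * r ≤ q * r
*-≤ʳ r 0≤r = ℚ.*-monoʳ-≤-nonNeg r {{nonNegative 0≤r}}

*-≤ˡ : ∀ {p q} r → 0ℚ ≤ r → p ≤ q → r * p ≤ r * q
*-≤ˡ r 0≤r = ℚ.*-monoˡ-≤-nonNeg r {{nonNegative 0≤r}}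

*-≤ : ∀ {p q r s} → 0ℚ ≤ r → 0ℚ ≤ q → p ≤ q → r ≤ s → p * r ≤ q * s
*-≤ 0≤r 0≤q p≤q r≤s = ℚ.≤-trans (*-≤ʳ _ 0≤r p≤q) (*-≤ˡ _ 0≤q r≤s)

0≤* : ∀ {p q} → 0ℚ ≤ p → 0ℚ ≤ q → 0ℚ ≤ p * q
0≤* {p} {q} 0≤p 0≤q = subst (_≤ p * q) (ℚ.*-zeroˡ q) (*-≤ʳ q 0≤q 0≤p)

0≤+ : ∀ {p q} → 0ℚ ≤ p → 0ℚ ≤ q → 0ℚ ≤ p + q
0≤+ = +-≤

0<* : ∀ {p q} → 0ℚ < p → 0ℚ < q → 0ℚ < p * q
0<* {p} {q} 0<p 0<q = ℚ.positive⁻¹ _ {{ℚ.pos*pos⇒pos p {{positive 0<p}} q {{positive 0<q}}}}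

p≤p+q : ∀ {p q} → 0ℚ ≤ q → p ≤ p + q
p≤p+q {p} {q} 0≤q = subst (λ z → z ≤ p + q) (ℚ.+-identityʳ p) (ℚ.+-monoʳ-≤ p 0≤q)

q≤p+q : ∀ {p q} → 0ℚ ≤ p → q ≤ p + q
q≤p+q {p} {q} 0≤p = subst (λ z → z ≤ p + q) (ℚ.+-identityˡ q) (ℚ.+-monoˡ-≤ q 0≤p)

p≤∣p∣ : ∀ p → p ≤ ∣ p ∣
p≤∣p∣ p with ℚ.≤-total 0ℚ p
... | inj₁ 0≤p = ℚ.≤-reflexive (sym (ℚ.0≤p⇒∣p∣≡p 0≤p))
... | inj₂ p≤0 = ℚ.≤-trans p≤0 (ℚ.0≤∣p∣ p)

∣-∣-sym : ∀ p q → ∣ p - q ∣ ≡ ∣ q - p ∣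
∣-∣-sym p q = trans (sym (ℚ.∣-p∣≡∣p∣ (p - q)))
  (cong ∣_∣ (solve 2 (λ p q → :- (p :- q) := q :- p) refl p q))

∣-∣-intro : ∀ {p q r} → p ≤ q + r → q ≤ p + r → ∣ p - q ∣ ≤ r
∣-∣-intro {p} {q} {r} p≤q+r q≤p+r with ℚ.∣p∣≡p∨∣p∣≡-p (p - q)
... | inj₁ eq = begin
  ∣ p - q ∣   ≡⟨ eq ⟩
  p - q       ≤⟨ ℚ.+-monoˡ-≤ (- q) p≤q+r ⟩
  q + r - q   ≡⟨ solve 2 (λ q r → q :+ r :- q := r) refl q r ⟩
  r           ∎
... | inj₂ eq = begin
  ∣ p - q ∣   ≡⟨ eq ⟩
  - (p - q)   ≡⟨ solve 2 (λ p q → :- (p :- q) := q :- p) refl p q ⟩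
  q - p       ≤⟨ ℚ.+-monoˡ-≤ (- p) q≤p+r ⟩
  p + r - p   ≡⟨ solve 2 (λ q r → q :+ r :- q := r) refl p r ⟩
  r           ∎

∣-∣-elim : ∀ {p q r} → ∣ p - q ∣ ≤ r → p ≤ q + r
∣-∣-elim {p} {q} {r} h = begin
  p              ≡⟨ solve 2 (λ p q → p := q :+ (p :- q)) refl p q ⟩
  q + (p - q)    ≤⟨ ℚ.+-monoʳ-≤ q (ℚ.≤-trans (p≤∣p∣ (p - q)) h) ⟩
  q + r          ∎

∣-∣-triangle : ∀ p q r → ∣ p - r ∣ ≤ ∣ p - q ∣ + ∣ q - r ∣
∣-∣-triangle p q r = begin
  ∣ p - r ∣               ≡⟨ cong ∣_∣ (solve 3 (λ p q r → p :- r := (p :- q) :+ (q :- r)) refl p q r) ⟩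
  ∣ (p - q) + (q - r) ∣   ≤⟨ ℚ.∣p+q∣≤∣p∣+∣q∣ (p - q) (q - r) ⟩
  ∣ p - q ∣ + ∣ q - r ∣   ∎

fromℕ-mono : ∀ {m n} → m ℕ.≤ n → fromℕ m ≤ fromℕ n
fromℕ-mono {m} m≤n = go (ℕ.≤⇒≤′ m≤n)
  where
  go : ∀ {n} → m ℕ.≤′ n → fromℕ m ≤ fromℕ n
  go (ℕ.≤′-reflexive refl)        = ℚ.≤-refl
  go {suc n} (ℕ.≤′-step h) = ℚ.≤-trans (go h) (subst (fromℕ n ≤_) (sym (fromℕ-suc n)) (q≤p+q 0≤1))

fromℕ-+ : ∀ m n → fromℕ (m ℕ.+ n) ≡ fromℕ m + fromℕ n
fromℕ-+ zero    n = sym (ℚ.+-identityˡ (fromℕ n))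
fromℕ-+ (suc m) n = trans (fromℕ-suc (m ℕ.+ n)) (trans (cong (1ℚ +_) (fromℕ-+ m n))
  (trans (sym (ℚ.+-assoc 1ℚ (fromℕ m) (fromℕ n))) (cong (_+ fromℕ n) (sym (fromℕ-suc m)))))

fromℕ-* : ∀ m n → fromℕ (m ℕ.* n) ≡ fromℕ m * fromℕ n
fromℕ-* zero    n = sym (ℚ.*-zeroˡ (fromℕ n))
fromℕ-* (suc m) n = trans (fromℕ-+ n (m ℕ.* n)) (trans (cong (λ z → fromℕ n + z) (fromℕ-* m n))
  (trans (solve 2 (λ m n → n :+ m :* n := (con 1ℚ :+ m) :* n) refl (fromℕ m) (fromℕ n))
         (cong (_* fromℕ n) (sym (fromℕ-suc m)))))

1/suc≤1 : ∀ n → 1/suc n ≤ 1ℚ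
1/suc≤1 n = begin
  1/suc n                    ≡⟨ sym (ℚ.*-identityˡ (1/suc n)) ⟩
  1ℚ * 1/suc n               ≤⟨ *-≤ʳ (1/suc n) (0≤1/suc n) (fromℕ-mono {1} {suc n} (ℕ.s≤s ℕ.z≤n)) ⟩
  fromℕ (suc n) * 1/suc n    ≡⟨ 1/suc-inverse n ⟩
  1ℚ                         ∎

Small : (ℕ → ℕ → ℚ) → Set
Small a = ∀ ε → 0ℚ < ε → ∃ λ N → ∀ m n → N ℕ.≤ m → N ℕ.≤ n → a m n ≤ ε

small-mono : ∀ {a b} → (∃ λ N → ∀ m n → N ℕ.≤ m → N ℕ.≤ n → a m n ≤ b m n) → Small b → Small a
small-mono (N₀ , a≤b) sb ε 0<ε with sb ε 0<ε
... | N , b≤ε = N₀ ℕ.⊔ N , λ m n hm hn → ℚ.≤-trans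
  (a≤b m n (ℕ.m⊔n≤o⇒m≤o N₀ N hm) (ℕ.m⊔n≤o⇒m≤o N₀ N hn))
  (b≤ε m n (ℕ.m⊔n≤o⇒n≤o N₀ N hm) (ℕ.m⊔n≤o⇒n≤o N₀ N hn))

small-+ : ∀ {a b} → Small a → Small b → Small (λ m n → a m n + b m n)
small-+ sa sb ε 0<ε with sa (ε * ½) (0<* 0<ε (ℚ.positive⁻¹ ½)) | sb (ε * ½) (0<* 0<ε (ℚ.positive⁻¹ ½))
... | N₁ , a≤ | N₂ , b≤ = N₁ ℕ.⊔ N₂ , λ m n hm hn → ℚ.≤-trans
  (+-≤ (a≤ m n (ℕ.m⊔n≤o⇒m≤o N₁ N₂ hm) (ℕ.m⊔n≤o⇒m≤o N₁ N₂ hn))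
       (b≤ m n (ℕ.m⊔n≤o⇒n≤o N₁ N₂ hm) (ℕ.m⊔n≤o⇒n≤o N₁ N₂ hn)))
  (ℚ.≤-reflexive (solve 1 (λ x → x :* con ½ :+ x :* con ½ := x) refl ε))

small-* : ∀ {a} K → Small a → Small (λ m n → fromℕ (suc K) * a m n)
small-* {a} K sa ε 0<ε with sa (ε * 1/suc K) (0<* 0<ε (0<1/suc K))
... | N , a≤ = N , λ m n hm hn → begin
  fromℕ (suc K) * a m n              ≤⟨ *-≤ˡ _ (0≤fromℕ (suc K)) (a≤ m n hm hn) ⟩
  fromℕ (suc K) * (ε * 1/suc K)      ≡⟨ solve 3 (λ k x i → k :* (x :* i) := x :* (k :* i)) refl (fromℕ (suc K)) ε (1/suc K) ⟩
  ε * (fromℕ (suc K) * 1/suc K)      ≡⟨ cong (ε *_) (1/suc-inverse K) ⟩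
  ε * 1ℚ                             ≡⟨ ℚ.*-identityʳ ε ⟩
  ε                                  ∎

small-1/suc : Small (λ m n → 1/suc m)
small-1/suc ε 0<ε = N , λ m n N≤m _ → begin
  1/suc m                    ≡⟨ sym (ℚ.*-identityʳ (1/suc m)) ⟩
  1/suc m * 1ℚ               ≡⟨ cong (1/suc m *_) (sym (ℚ.*-inverseˡ ε)) ⟩
  1/suc m * (1/ ε * ε)       ≤⟨ *-≤ˡ _ (0≤1/suc m) (*-≤ʳ ε (ℚ.<⇒≤ 0<ε)
                                   (ℚ.≤-trans (≤-archimedean (1/ ε)) (fromℕ-mono (ℕ.m≤n⇒m≤1+n N≤m)))) ⟩
  1/suc m * (fromℕ (suc m) * ε) ≡⟨ solve 3 (λ i k x → i :* (k :* x) := (k :* i) :* x) refl (1/suc m) (fromℕ (suc m)) ε ⟩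
  (fromℕ (suc m) * 1/suc m) * ε ≡⟨ cong (_* ε) (1/suc-inverse m) ⟩
  1ℚ * ε                     ≡⟨ ℚ.*-identityˡ ε ⟩
  ε                          ∎
  where
  instance
    ε≢0 : NonZero ε
    ε≢0 = >-nonZero 0<ε
  N : ℕ
  N = ℤ.∣ ↥ (1/ ε) ∣

small-swap : ∀ {a} → Small a → Small (λ m n → a n m)
small-swap sa ε 0<ε with sa ε 0<ε
... | N , a≤ = N , λ m n hm hn → a≤ n m hn hm

-- Cauchy sequences of rationals, compared by _≃ℝ_.
record ℝ : Set where
  constructor real
  field
    seq    : ℕ → ℚ
    cauchy : Small (λ m n → ∣ seq m - seq n ∣)

open ℝ public

infix 4 _≤ℝ_ _<ℝ_ _≃ℝ_

_≤ℝ_ : ℝ → ℝ → Set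
x ≤ℝ y = ∀ ε → 0ℚ < ε → ∃ λ N → ∀ n → N ℕ.≤ n → seq x n ≤ seq y n + ε

_<ℝ_ : ℝ → ℝ → Set
x <ℝ y = ∃ λ ε → 0ℚ < ε × ∃ λ N → ∀ n → N ℕ.≤ n → seq x n + ε ≤ seq y n

_≃ℝ_ : ℝ → ℝ → Set
x ≃ℝ y = x ≤ℝ y × y ≤ℝ x

fromℚ : ℚ → ℝ
fromℚ q = real (λ _ → q) λ ε 0<ε → 0 , λ m n _ _ → begin
  ∣ q - q ∣   ≡⟨ cong ∣_∣ (ℚ.+-inverseʳ q) ⟩
  0ℚ          ≤⟨ ℚ.<⇒≤ 0<ε ⟩
  ε           ∎

fromℕℝ : ℕ → ℝ
fromℕℝ n = fromℚ (fromℕ n)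

infixl 6 _+ℝ_
infixl 7 _*ℝ_

_+ℝ_ : ℝ → ℝ → ℝ
x +ℝ y = real (λ n → seq x n + seq y n)
  (small-mono (0 , λ m n _ _ → bound (seq x m) (seq y m) (seq x n) (seq y n))
              (small-+ (cauchy x) (cauchy y)))
  where
  bound : ∀ a b c d → ∣ (a + b) - (c + d) ∣ ≤ ∣ a - c ∣ + ∣ b - d ∣
  bound a b c d = begin
    ∣ (a + b) - (c + d) ∣    ≡⟨ cong ∣_∣ (solve 4 (λ a b c d → (a :+ b) :- (c :+ d) := (a :- c) :+ (b :- d)) refl a b c d) ⟩
    ∣ (a - c) + (b - d) ∣    ≤⟨ ℚ.∣p+q∣≤∣p∣+∣q∣ (a - c) (b - d) ⟩
    ∣ a - c ∣ + ∣ b - d ∣    ∎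

bounded : ∀ x → ∃ λ K → ∃ λ N → ∀ n → N ℕ.≤ n → ∣ seq x n ∣ ≤ fromℕ (suc K)
bounded x with cauchy x 1ℚ 0<1
... | N , near = K , N , λ n N≤n → begin
  ∣ seq x n ∣                          ≡⟨ cong ∣_∣ (solve 2 (λ a b → a := (a :- b) :+ b) refl (seq x n) (seq x N)) ⟩
  ∣ (seq x n - seq x N) + seq x N ∣    ≤⟨ ℚ.∣p+q∣≤∣p∣+∣q∣ (seq x n - seq x N) (seq x N) ⟩
  ∣ seq x n - seq x N ∣ + ∣ seq x N ∣  ≤⟨ +-≤ (near n N N≤n ℕ.≤-refl) (≤-archimedean ∣ seq x N ∣) ⟩
  1ℚ + fromℕ K                         ≡⟨ sym (fromℕ-suc K) ⟩
  fromℕ (suc K)                        ∎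
  where
  K : ℕ
  K = ℤ.∣ ↥ ∣ seq x N ∣ ∣

_*ℝ_ : ℝ → ℝ → ℝ
x *ℝ y = real (λ n → seq x n * seq y n) small
  where
  bound : ∀ {k l} a b c d → ∣ a ∣ ≤ k → ∣ d ∣ ≤ l →
          ∣ a * b - c * d ∣ ≤ k * ∣ b - d ∣ + l * ∣ a - c ∣
  bound {k} {l} a b c d ha hd = begin
    ∣ a * b - c * d ∣                    ≡⟨ cong ∣_∣ (solve 4 (λ a b c d → a :* b :- c :* d := a :* (b :- d) :+ d :* (a :- c)) refl a b c d) ⟩
    ∣ a * (b - d) + d * (a - c) ∣        ≤⟨ ℚ.∣p+q∣≤∣p∣+∣q∣ (a * (b - d)) (d * (a - c)) ⟩
    ∣ a * (b - d) ∣ + ∣ d * (a - c) ∣    ≡⟨ cong₂ _+_ (ℚ.∣p*q∣≡∣p∣*∣q∣ a (b - d)) (ℚ.∣p*q∣≡∣p∣*∣q∣ d (a - c)) ⟩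
    ∣ a ∣ * ∣ b - d ∣ + ∣ d ∣ * ∣ a - c ∣
      ≤⟨ +-≤ (*-≤ʳ ∣ b - d ∣ (ℚ.0≤∣p∣ (b - d)) ha) (*-≤ʳ ∣ a - c ∣ (ℚ.0≤∣p∣ (a - c)) hd) ⟩
    k * ∣ b - d ∣ + l * ∣ a - c ∣        ∎
  small : Small (λ m n → ∣ seq x m * seq y m - seq x n * seq y n ∣)
  small = let (K , N₁ , x≤) = bounded x ; (L , N₂ , y≤) = bounded y in small-mono
    {λ m n → ∣ seq x m * seq y m - seq x n * seq y n ∣}
    {λ m n → fromℕ (suc K) * ∣ seq y m - seq y n ∣ + fromℕ (suc L) * ∣ seq x m - seq x n ∣}
    (N₁ ℕ.⊔ N₂ , λ m n hm hn → bound (seq x m) (seq y m) (seq x n) (seq y n)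
      (x≤ m (ℕ.m⊔n≤o⇒m≤o N₁ N₂ hm)) (y≤ n (ℕ.m⊔n≤o⇒n≤o N₁ N₂ hn)))
    (small-+ {λ m n → fromℕ (suc K) * ∣ seq y m - seq y n ∣}
             {λ m n → fromℕ (suc L) * ∣ seq x m - seq x n ∣}
             (small-* {λ m n → ∣ seq y m - seq y n ∣} K (cauchy y))
             (small-* {λ m n → ∣ seq x m - seq x n ∣} L (cauchy x)))

-- term i x = xⁱ / i!
term : ℕ → ℚ → ℚ
term zero    x = 1ℚ
term (suc i) x = term i x * x * 1/suc i

partialExp : ℕ → ℚ → ℚ
partialExp zero    x = 0ℚ
partialExp (suc n) x = partialExp n x + term n x

0≤term : ∀ i {x} → 0ℚ ≤ x → 0ℚ ≤ term i x
0≤term zero    0≤x = 0≤1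
0≤term (suc i) 0≤x = 0≤* (0≤* (0≤term i 0≤x) 0≤x) (0≤1/suc i)

term-mono : ∀ i {x y} → 0ℚ ≤ x → x ≤ y → term i x ≤ term i y
term-mono zero    0≤x x≤y = ℚ.≤-refl
term-mono (suc i) 0≤x x≤y = *-≤ʳ (1/suc i) (0≤1/suc i)
  (*-≤ 0≤x (0≤term i (ℚ.≤-trans 0≤x x≤y)) (term-mono i 0≤x x≤y) x≤y)

∣term∣ : ∀ i x → ∣ term i x ∣ ≡ term i ∣ x ∣
∣term∣ zero    x = refl
∣term∣ (suc i) x = begin-equality
  ∣ term i x * x * 1/suc i ∣             ≡⟨ ℚ.∣p*q∣≡∣p∣*∣q∣ (term i x * x) (1/suc i) ⟩
  ∣ term i x * x ∣ * ∣ 1/suc i ∣         ≡⟨ cong₂ _*_ (ℚ.∣p*q∣≡∣p∣*∣q∣ (term i x) x) (ℚ.0≤p⇒∣p∣≡p (0≤1/suc i)) ⟩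
  ∣ term i x ∣ * ∣ x ∣ * 1/suc i         ≡⟨ cong (λ t → t * ∣ x ∣ * 1/suc i) (∣term∣ i x) ⟩
  term i ∣ x ∣ * ∣ x ∣ * 1/suc i         ∎

∣term∣≤ : ∀ i {x k} → ∣ x ∣ ≤ k → ∣ term i x ∣ ≤ term i k
∣term∣≤ i {x} {k} x≤k = subst (λ t → t ≤ term i k) (sym (∣term∣ i x)) (term-mono i (ℚ.0≤∣p∣ x) x≤k)

term-lipschitz : ∀ i {x y k} → ∣ x ∣ ≤ k → ∣ y ∣ ≤ k →
                 ∣ term (suc i) x - term (suc i) y ∣ ≤ term i k * ∣ x - y ∣
term-lipschitz zero {x} {y} x≤k y≤k = ℚ.≤-reflexive
  (trans (cong ∣_∣ (identity x y)) (sym (ℚ.*-identityˡ ∣ x - y ∣)))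
  where
  identity : ∀ x y → 1ℚ * x * 1ℚ - 1ℚ * y * 1ℚ ≡ x - y
  identity = solve 2 (λ x y → con 1ℚ :* x :* con 1ℚ :- con 1ℚ :* y :* con 1ℚ := x :- y) refl
term-lipschitz (suc i) {x} {y} {k} x≤k y≤k = begin
  ∣ tx * x * j - ty * y * j ∣                       ≡⟨ cong ∣_∣ (expand tx x ty y j) ⟩
  ∣ (tx * (x - y) + (tx - ty) * y) * j ∣            ≡⟨ ℚ.∣p*q∣≡∣p∣*∣q∣ (tx * (x - y) + (tx - ty) * y) j ⟩
  ∣ tx * (x - y) + (tx - ty) * y ∣ * ∣ j ∣          ≡⟨ cong (∣ tx * (x - y) + (tx - ty) * y ∣ *_) (ℚ.0≤p⇒∣p∣≡p 0≤j) ⟩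
  ∣ tx * (x - y) + (tx - ty) * y ∣ * j              ≤⟨ *-≤ʳ j 0≤j (ℚ.∣p+q∣≤∣p∣+∣q∣ (tx * (x - y)) ((tx - ty) * y)) ⟩
  (∣ tx * (x - y) ∣ + ∣ (tx - ty) * y ∣) * j        ≡⟨ cong (_* j) (cong₂ _+_ (ℚ.∣p*q∣≡∣p∣*∣q∣ tx (x - y)) (ℚ.∣p*q∣≡∣p∣*∣q∣ (tx - ty) y)) ⟩
  (∣ tx ∣ * d + ∣ tx - ty ∣ * ∣ y ∣) * j
    ≤⟨ *-≤ʳ j 0≤j (+-≤ (*-≤ʳ d 0≤d (∣term∣≤ (suc i) x≤k))
                       (*-≤ (ℚ.0≤∣p∣ y) (0≤* (0≤term i 0≤k) 0≤d) (term-lipschitz i x≤k y≤k) y≤k)) ⟩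
  (t * k * i′ * d + t * d * k) * j                  ≡⟨ cong (λ z → (t * k * i′ * d + z) * j) (rearrange t d k) ⟩
  (t * k * i′ * d + t * k * 1ℚ * d) * j             ≡⟨ cong (λ z → (t * k * i′ * d + t * k * z * d) * j) (sym (1/suc-inverse i)) ⟩
  (t * k * i′ * d + t * k * (fromℕ (suc i) * i′) * d) * j
    ≡⟨ collect t k i′ d (fromℕ (suc i)) j ⟩
  (t * k * i′ * d) * ((1ℚ + fromℕ (suc i)) * j)     ≡⟨ cong (λ z → (t * k * i′ * d) * (z * j)) (sym (fromℕ-suc (suc i))) ⟩
  (t * k * i′ * d) * (fromℕ (suc (suc i)) * j)      ≡⟨ cong ((t * k * i′ * d) *_) (1/suc-inverse (suc i)) ⟩
  (t * k * i′ * d) * 1ℚ                             ≡⟨ ℚ.*-identityʳ (t * k * i′ * d) ⟩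
  t * k * i′ * d                                    ∎
  where
  tx = term (suc i) x
  ty = term (suc i) y
  t  = term i k
  d  = ∣ x - y ∣
  i′ = 1/suc i
  j  = 1/suc (suc i)
  0≤j : 0ℚ ≤ j
  0≤j = 0≤1/suc (suc i)
  0≤d : 0ℚ ≤ d
  0≤d = ℚ.0≤∣p∣ (x - y)
  0≤k : 0ℚ ≤ k
  0≤k = ℚ.≤-trans (ℚ.0≤∣p∣ x) x≤k
  expand : ∀ s x t y j → s * x * j - t * y * j ≡ (s * (x - y) + (s - t) * y) * j
  expand = solve 5 (λ s x t y j → s :* x :* j :- t :* y :* j := (s :* (x :- y) :+ (s :- t) :* y) :* j) refl
  rearrange : ∀ t d k → t * d * k ≡ t * k * 1ℚ * d
  rearrange = solve 3 (λ t d k → t :* d :* k := t :* k :* con 1ℚ :* d) refl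
  collect : ∀ t k i d n j → (t * k * i * d + t * k * (n * i) * d) * j ≡ (t * k * i * d) * ((1ℚ + n) * j)
  collect = solve 6 (λ t k i d n j → (t :* k :* i :* d :+ t :* k :* (n :* i) :* d) :* j := (t :* k :* i :* d) :* ((con 1ℚ :+ n) :* j)) refl

partialExp-mono : ∀ {m n k} → 0ℚ ≤ k → m ℕ.≤ n → partialExp m k ≤ partialExp n k
partialExp-mono {m} {k = k} 0≤k m≤n = go (ℕ.≤⇒≤′ m≤n)
  where
  go : ∀ {n} → m ℕ.≤′ n → partialExp m k ≤ partialExp n k
  go (ℕ.≤′-reflexive refl) = ℚ.≤-refl
  go {suc n} (ℕ.≤′-step h) = ℚ.≤-trans (go h) (p≤p+q (0≤term n 0≤k))

partialExp-lipschitz : ∀ n {x y k} → ∣ x ∣ ≤ k → ∣ y ∣ ≤ k →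
                       ∣ partialExp n x - partialExp n y ∣ ≤ partialExp n k * ∣ x - y ∣
partialExp-lipschitz n {x} {y} {k} x≤k y≤k = ℚ.≤-trans (shifted n)
  (*-≤ʳ ∣ x - y ∣ (ℚ.0≤∣p∣ (x - y)) (partialExp-mono 0≤k (ℕ.m∸n≤m n 1)))
  where
  0≤k : 0ℚ ≤ k
  0≤k = ℚ.≤-trans (ℚ.0≤∣p∣ x) x≤k
  step : ∀ a b c d → ∣ (a + b) - (c + d) ∣ ≤ ∣ a - c ∣ + ∣ b - d ∣
  step a b c d = ℚ.≤-trans (ℚ.≤-reflexive (cong ∣_∣
      (solve 4 (λ a b c d → (a :+ b) :- (c :+ d) := (a :- c) :+ (b :- d)) refl a b c d)))
    (ℚ.∣p+q∣≤∣p∣+∣q∣ (a - c) (b - d))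
  shifted : ∀ n → ∣ partialExp n x - partialExp n y ∣ ≤ partialExp (n ℕ.∸ 1) k * ∣ x - y ∣
  shifted zero          = ℚ.≤-reflexive (sym (ℚ.*-zeroˡ ∣ x - y ∣))
  shifted (suc zero)    = ℚ.≤-reflexive (sym (ℚ.*-zeroˡ ∣ x - y ∣))
  shifted (suc (suc n)) = begin
    ∣ (partialExp (suc n) x + term (suc n) x) - (partialExp (suc n) y + term (suc n) y) ∣
      ≤⟨ step (partialExp (suc n) x) (term (suc n) x) (partialExp (suc n) y) (term (suc n) y) ⟩
    ∣ partialExp (suc n) x - partialExp (suc n) y ∣ + ∣ term (suc n) x - term (suc n) y ∣
      ≤⟨ +-≤ (shifted (suc n)) (term-lipschitz n x≤k y≤k) ⟩
    partialExp n k * ∣ x - y ∣ + term n k * ∣ x - y ∣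
      ≡⟨ sym (ℚ.*-distribʳ-+ ∣ x - y ∣ (partialExp n k) (term n k)) ⟩
    (partialExp n k + term n k) * ∣ x - y ∣ ∎

-- For n ≥ 2K the terms at K at least halve at each step.
term-halves : ∀ K n → K ℕ.+ K ℕ.≤ n →
              term (suc n) (fromℕ K) + term (suc n) (fromℕ K) ≤ term n (fromℕ K)
term-halves K n 2K≤n = begin
  t * k * i + t * k * i               ≡⟨ rearrange t k i ⟩
  t * ((k + k) * i)                   ≤⟨ *-≤ˡ t (0≤term n (0≤fromℕ K)) (*-≤ʳ i (0≤1/suc n) 2k≤) ⟩
  t * (fromℕ (suc n) * i)             ≡⟨ cong (t *_) (1/suc-inverse n) ⟩
  t * 1ℚ                              ≡⟨ ℚ.*-identityʳ t ⟩
  t                                   ∎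
  where
  k = fromℕ K
  t = term n k
  i = 1/suc n
  2k≤ : k + k ≤ fromℕ (suc n)
  2k≤ = subst (λ z → z ≤ fromℕ (suc n)) (fromℕ-+ K K) (fromℕ-mono (ℕ.m≤n⇒m≤1+n 2K≤n))
  rearrange : ∀ t k i → t * k * i + t * k * i ≡ t * ((k + k) * i)
  rearrange = solve 3 (λ t k i → t :* k :* i :+ t :* k :* i := t :* ((k :+ k) :* i)) refl

twice : ℚ → ℚ
twice q = q + q

0≤2term : ∀ K n → 0ℚ ≤ twice (term n (fromℕ K))
0≤2term K n = 0≤+ (0≤term n (0≤fromℕ K)) (0≤term n (0≤fromℕ K))

partialExp-tail : ∀ K {n m} → K ℕ.+ K ℕ.≤ n → n ℕ.≤ m →
                  partialExp m (fromℕ K) ≤ partialExp n (fromℕ K) + twice (term n (fromℕ K))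
partialExp-tail K {n} {m} 2K≤n n≤m =
  ℚ.≤-trans (p≤p+q (0≤2term K m)) (go (ℕ.≤⇒≤′ n≤m))
  where
  k = fromℕ K
  go : ∀ {m} → n ℕ.≤′ m → partialExp m k + twice (term m k) ≤ partialExp n k + twice (term n k)
  go (ℕ.≤′-reflexive refl) = ℚ.≤-refl
  go {suc m} (ℕ.≤′-step h) = begin
    partialExp m k + term m k + twice (term (suc m) k)
      ≤⟨ ℚ.+-monoʳ-≤ (partialExp m k + term m k) (term-halves K m (ℕ.≤-trans 2K≤n (ℕ.≤′⇒≤ h))) ⟩
    partialExp m k + term m k + term m k    ≡⟨ ℚ.+-assoc (partialExp m k) (term m k) (term m k) ⟩
    partialExp m k + twice (term m k)       ≤⟨ go h ⟩
    partialExp n k + twice (term n k)       ∎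

partialExp-bounded : ∀ K → ∃ λ D → ∀ n → partialExp n (fromℕ K) ≤ fromℕ (suc D)
partialExp-bounded K = D , λ n → ℚ.≤-trans
  (ℚ.≤-trans (partialExp-mono (0≤fromℕ K) (ℕ.m≤n⊔m N₀ n)) (partialExp-tail K ℕ.≤-refl (ℕ.m≤m⊔n N₀ n)))
  (ℚ.≤-trans (≤-archimedean bound) (fromℕ-mono (ℕ.n≤1+n D)))
  where
  N₀ = K ℕ.+ K
  bound : ℚ
  bound = partialExp N₀ (fromℕ K) + twice (term N₀ (fromℕ K))
  D = ℤ.∣ ↥ bound ∣

partialExp-diff : ∀ {m n x k} → ∣ x ∣ ≤ k → n ℕ.≤ m →
                  ∣ partialExp m x - partialExp n x ∣ ≤ partialExp m k - partialExp n k
partialExp-diff {n = n} {x} {k} x≤k n≤m = go (ℕ.≤⇒≤′ n≤m)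
  where
  regroup : ∀ a b c → (a + b) - c ≡ (a - c) + b
  regroup = solve 3 (λ a b c → (a :+ b) :- c := (a :- c) :+ b) refl
  go : ∀ {m} → n ℕ.≤′ m → ∣ partialExp m x - partialExp n x ∣ ≤ partialExp m k - partialExp n k
  go (ℕ.≤′-reflexive refl) = ℚ.≤-reflexive
    (trans (cong ∣_∣ (ℚ.+-inverseʳ (partialExp n x))) (sym (ℚ.+-inverseʳ (partialExp n k))))
  go {suc m} (ℕ.≤′-step h) = begin
    ∣ (partialExp m x + term m x) - partialExp n x ∣    ≡⟨ cong ∣_∣ (regroup (partialExp m x) (term m x) (partialExp n x)) ⟩
    ∣ (partialExp m x - partialExp n x) + term m x ∣    ≤⟨ ℚ.∣p+q∣≤∣p∣+∣q∣ (partialExp m x - partialExp n x) (term m x) ⟩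
    ∣ partialExp m x - partialExp n x ∣ + ∣ term m x ∣  ≤⟨ +-≤ (go h) (∣term∣≤ m x≤k) ⟩
    (partialExp m k - partialExp n k) + term m k        ≡⟨ sym (regroup (partialExp m k) (term m k) (partialExp n k)) ⟩
    (partialExp m k + term m k) - partialExp n k        ∎

partialExp-later : ∀ K {x m n} → ∣ x ∣ ≤ fromℕ K → K ℕ.+ K ℕ.≤ n → n ℕ.≤ m →
  ∣ partialExp m x - partialExp n x ∣ ≤ twice (term n (fromℕ K))
partialExp-later K {x} {m} {n} x≤k 2K≤n n≤m = begin
  ∣ partialExp m x - partialExp n x ∣                 ≤⟨ partialExp-diff x≤k n≤m ⟩
  partialExp m (fromℕ K) - partialExp n (fromℕ K)     ≤⟨ ℚ.+-monoˡ-≤ (- partialExp n (fromℕ K)) (partialExp-tail K 2K≤n n≤m) ⟩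
  partialExp n (fromℕ K) + twice (term n (fromℕ K)) - partialExp n (fromℕ K)
    ≡⟨ solve 2 (λ q r → q :+ r :- q := r) refl (partialExp n (fromℕ K)) (twice (term n (fromℕ K))) ⟩
  twice (term n (fromℕ K))                            ∎

partialExp-close : ∀ K {x} m n → ∣ x ∣ ≤ fromℕ K → K ℕ.+ K ℕ.≤ m → K ℕ.+ K ℕ.≤ n →
  ∣ partialExp m x - partialExp n x ∣ ≤ twice (term m (fromℕ K)) + twice (term n (fromℕ K))
partialExp-close K {x} m n x≤k hm hn with ℕ.≤-total n m
... | inj₁ n≤m = ℚ.≤-trans (partialExp-later K x≤k hn n≤m) (q≤p+q (0≤2term K m))
... | inj₂ m≤n = ℚ.≤-trans (ℚ.≤-reflexive (∣-∣-sym (partialExp m x) (partialExp n x)))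
  (ℚ.≤-trans (partialExp-later K x≤k hm m≤n) (p≤p+q (0≤2term K n)))

small-shift : ∀ {a : ℕ → ℚ} → Small (λ m n → a (suc m)) → Small (λ m n → a m)
small-shift sa ε 0<ε with sa ε 0<ε
... | N , a≤ = suc N , λ { (suc m) (suc n) (ℕ.s≤s hm) (ℕ.s≤s hn) → a≤ m n hm hn }

small-term : ∀ K → Small (λ m n → term m (fromℕ K))
small-term K = small-shift {λ m → term m (fromℕ K)}
  (small-mono {λ m n → term (suc m) (fromℕ K)} {λ m n → fromℕ (suc L) * 1/suc m}
    (0 , λ m n _ _ → *-≤ʳ {term m (fromℕ K) * fromℕ K} {fromℕ (suc L)} (1/suc m) (0≤1/suc m) (coefficient m))
    (small-* {λ m n → 1/suc m} L small-1/suc))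
  where
  D = proj₁ (partialExp-bounded K)
  L = suc D ℕ.* K
  term≤ : ∀ m → term m (fromℕ K) ≤ fromℕ (suc D)
  term≤ m = ℚ.≤-trans (q≤p+q (partialExp-mono {0} {m} (0≤fromℕ K) ℕ.z≤n)) (proj₂ (partialExp-bounded K) (suc m))
  coefficient : ∀ m → term m (fromℕ K) * fromℕ K ≤ fromℕ (suc L)
  coefficient m = begin
    term m (fromℕ K) * fromℕ K              ≤⟨ *-≤ʳ (fromℕ K) (0≤fromℕ K) (term≤ m) ⟩
    fromℕ (suc D) * fromℕ K                 ≡⟨ sym (fromℕ-* (suc D) K) ⟩
    fromℕ (suc D ℕ.* K)                     ≤⟨ fromℕ-mono (ℕ.n≤1+n (suc D ℕ.* K)) ⟩
    fromℕ (suc L)                           ∎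

small-close : ∀ K → Small (λ m n → twice (term m (fromℕ K)) + twice (term n (fromℕ K)))
small-close K = small-+ {λ m n → twice (term m (fromℕ K))} {λ m n → twice (term n (fromℕ K))}
  two (small-swap {λ m n → twice (term m (fromℕ K))} two)
  where
  two : Small (λ m n → twice (term m (fromℕ K)))
  two = small-+ {λ m n → term m (fromℕ K)} {λ m n → term m (fromℕ K)} (small-term K) (small-term K)

partialExp-lipschitz-ℕ : ∀ K {D} → (∀ n → partialExp n (fromℕ K) ≤ fromℕ (suc D)) →
  ∀ n {x y} → ∣ x ∣ ≤ fromℕ K → ∣ y ∣ ≤ fromℕ K →
  ∣ partialExp n x - partialExp n y ∣ ≤ fromℕ (suc D) * ∣ x - y ∣
partialExp-lipschitz-ℕ K bound n {x} {y} x≤k y≤k = ℚ.≤-trans (partialExp-lipschitz n x≤k y≤k)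
  (*-≤ʳ ∣ x - y ∣ (ℚ.0≤∣p∣ (x - y)) (bound n))

small-partialExp : ∀ x K N D →
  (∀ n → N ℕ.≤ n → ∣ seq x n ∣ ≤ fromℕ K) → (∀ n → partialExp n (fromℕ K) ≤ fromℕ (suc D)) →
  Small (λ m n → ∣ partialExp m (seq x m) - partialExp n (seq x n) ∣)
small-partialExp x K N D x≤ bound = small-mono
  {λ m n → ∣ partialExp m (seq x m) - partialExp n (seq x n) ∣}
  {λ m n → (twice (term m (fromℕ K)) + twice (term n (fromℕ K))) + fromℕ (suc D) * ∣ seq x m - seq x n ∣}
  (N ℕ.⊔ N₀ , λ m n hm hn → ℚ.≤-trans
    (∣-∣-triangle (partialExp m (seq x m)) (partialExp n (seq x m)) (partialExp n (seq x n)))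
    (+-≤ (partialExp-close K m n (x≤ m (ℕ.m⊔n≤o⇒m≤o N N₀ hm)) (ℕ.m⊔n≤o⇒n≤o N N₀ hm) (ℕ.m⊔n≤o⇒n≤o N N₀ hn))
         (partialExp-lipschitz-ℕ K {D} bound n (x≤ m (ℕ.m⊔n≤o⇒m≤o N N₀ hm)) (x≤ n (ℕ.m⊔n≤o⇒m≤o N N₀ hn)))))
  (small-+ {λ m n → twice (term m (fromℕ K)) + twice (term n (fromℕ K))}
           {λ m n → fromℕ (suc D) * ∣ seq x m - seq x n ∣}
           (small-close K) (small-* {λ m n → ∣ seq x m - seq x n ∣} D (cauchy x)))
  where
  N₀ = K ℕ.+ K

-- The diagonal sequence n ↦ Σ_{i<n} xₙⁱ / i!.
exp : ℝ → ℝ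
exp x = real (λ n → partialExp n (seq x n))
  (let K , N , x≤ = bounded x
       D , bound  = partialExp-bounded (suc K)
   in small-partialExp x (suc K) N D x≤ bound)

-- The largest j ≤ J satisfying P (0 if there is none).
largest : {P : ℕ → Set} → Decidable P → ℕ → ℕ
largest P? zero    = zero
largest P? (suc J) with P? (suc J)
... | yes _ = suc J
... | no  _ = largest P? J

largest-satisfies : ∀ {P : ℕ → Set} (P? : Decidable P) J → P 0 → P (largest P? J)
largest-satisfies P? zero    P0 = P0
largest-satisfies P? (suc J) P0 with P? (suc J)
... | yes PJ = PJ
... | no  _  = largest-satisfies P? J P0

largest-maximal : ∀ {P : ℕ → Set} (P? : Decidable P) J → ¬ P (suc J) → ¬ P (suc (largest P? J))
largest-maximal P? zero    ¬P = ¬P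
largest-maximal P? (suc J) ¬P with P? (suc J)
... | yes _  = ¬P
... | no ¬PJ = largest-maximal P? J ¬PJ

gridBelow? : ∀ n y j → Dec (partialExp n (fromℕ j * 1/suc n) ≤ y)
gridBelow? n y j = partialExp n (fromℕ j * 1/suc n) ℚ.≤? y

-- The largest multiple l of 1/(n+1) with Σ_{i<n} lⁱ / i! ≤ y, searched for in [0 , ∣y∣ + 1].
gridLog : ℕ → ℚ → ℚ
gridLog n y = fromℕ (largest (gridBelow? n y) (suc n ℕ.* ℤ.∣ ↥ y ∣)) * 1/suc n

partialExp-0 : ∀ n → partialExp (suc n) 0ℚ ≡ 1ℚ
partialExp-0 zero    = refl
partialExp-0 (suc n) = trans (cong₂ _+_ (partialExp-0 n)
  (trans (cong (_* 1/suc n) (ℚ.*-zeroʳ (term n 0ℚ))) (ℚ.*-zeroˡ (1/suc n)))) (ℚ.+-identityʳ 1ℚ)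

-- Partial sums with at least two terms expand distances on [0 , ∞).
partialExp-expands : ∀ {n a b} → 2 ℕ.≤ n → 0ℚ ≤ a → a ≤ b →
                     b + partialExp n a ≤ a + partialExp n b
partialExp-expands {a = a} {b} 2≤n 0≤a a≤b = go (ℕ.≤⇒≤′ 2≤n)
  where
  linear : ∀ a b → b + (0ℚ + 1ℚ + 1ℚ * a * 1ℚ) ≡ a + (0ℚ + 1ℚ + 1ℚ * b * 1ℚ)
  linear = solve 2 (λ a b → b :+ (con 0ℚ :+ con 1ℚ :+ con 1ℚ :* a :* con 1ℚ) := a :+ (con 0ℚ :+ con 1ℚ :+ con 1ℚ :* b :* con 1ℚ)) refl
  go : ∀ {n} → 2 ℕ.≤′ n → b + partialExp n a ≤ a + partialExp n b
  go (ℕ.≤′-reflexive refl) = ℚ.≤-reflexive (linear a b)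
  go {suc n} (ℕ.≤′-step h) = begin
    b + (partialExp n a + term n a)    ≡⟨ sym (ℚ.+-assoc b (partialExp n a) (term n a)) ⟩
    (b + partialExp n a) + term n a    ≤⟨ +-≤ (go h) (term-mono n 0≤a a≤b) ⟩
    (a + partialExp n b) + term n b    ≡⟨ ℚ.+-assoc a (partialExp n b) (term n b) ⟩
    a + (partialExp n b + term n b)    ∎

partialExp-expands-∣∣ : ∀ {n a b} → 2 ℕ.≤ n → 0ℚ ≤ a → 0ℚ ≤ b →
                        ∣ a - b ∣ ≤ ∣ partialExp n a - partialExp n b ∣
partialExp-expands-∣∣ {n} {a} {b} 2≤n 0≤a 0≤b with ℚ.≤-total a b
... | inj₁ a≤b = ordered a b 0≤a a≤b
  where
  ordered : ∀ a b → 0ℚ ≤ a → a ≤ b → ∣ a - b ∣ ≤ ∣ partialExp n a - partialExp n b ∣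
  ordered a b 0≤a a≤b = ∣-∣-intro (ℚ.≤-trans a≤b (p≤p+q (ℚ.0≤∣p∣ (partialExp n a - partialExp n b)))) (begin
    b                                               ≡⟨ solve 2 (λ b s → b := (b :+ s) :- s) refl b (partialExp n a) ⟩
    b + partialExp n a - partialExp n a             ≤⟨ ℚ.+-monoˡ-≤ (- partialExp n a) (partialExp-expands 2≤n 0≤a a≤b) ⟩
    a + partialExp n b - partialExp n a             ≡⟨ ℚ.+-assoc a (partialExp n b) (- partialExp n a) ⟩
    a + (partialExp n b - partialExp n a)           ≤⟨ ℚ.+-monoʳ-≤ a (p≤∣p∣ (partialExp n b - partialExp n a)) ⟩
    a + ∣ partialExp n b - partialExp n a ∣         ≡⟨ cong (λ z → a + z) (∣-∣-sym (partialExp n b) (partialExp n a)) ⟩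
    a + ∣ partialExp n a - partialExp n b ∣         ∎)
... | inj₂ b≤a = ∣-∣-intro (begin
    a                                               ≡⟨ solve 2 (λ b s → b := (b :+ s) :- s) refl a (partialExp n b) ⟩
    a + partialExp n b - partialExp n b             ≤⟨ ℚ.+-monoˡ-≤ (- partialExp n b) (partialExp-expands 2≤n 0≤b b≤a) ⟩
    b + partialExp n a - partialExp n b             ≡⟨ ℚ.+-assoc b (partialExp n a) (- partialExp n b) ⟩
    b + (partialExp n a - partialExp n b)           ≤⟨ ℚ.+-monoʳ-≤ b (p≤∣p∣ (partialExp n a - partialExp n b)) ⟩
    b + ∣ partialExp n a - partialExp n b ∣         ∎)
  (ℚ.≤-trans b≤a (p≤p+q (ℚ.0≤∣p∣ (partialExp n a - partialExp n b))))

0≤gridLog : ∀ n y → 0ℚ ≤ gridLog n y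
0≤gridLog n y = 0≤* (0≤fromℕ (largest (gridBelow? n y) (suc n ℕ.* ℤ.∣ ↥ y ∣))) (0≤1/suc n)

-- 1 + a ≤ Σ_{i<n} aⁱ / i!
partialExp-growth : ∀ {n a} → 2 ℕ.≤ n → 0ℚ ≤ a → a + 1ℚ ≤ partialExp n a
partialExp-growth {suc n} {a} 2≤n 0≤a = begin
  a + 1ℚ                         ≡⟨ cong (λ z → a + z) (sym (partialExp-0 n)) ⟩
  a + partialExp (suc n) 0ℚ      ≤⟨ partialExp-expands 2≤n ℚ.≤-refl 0≤a ⟩
  0ℚ + partialExp (suc n) a      ≡⟨ ℚ.+-identityˡ (partialExp (suc n) a) ⟩
  partialExp (suc n) a           ∎

gridLog-lower : ∀ {n y} → 2 ℕ.≤ n → 1ℚ ≤ y → partialExp n (gridLog n y) ≤ y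
gridLog-lower {suc n} {y} 2≤n 1≤y =
  largest-satisfies (gridBelow? (suc n) y) (suc (suc n) ℕ.* ℤ.∣ ↥ y ∣) (begin
    partialExp (suc n) (fromℕ 0 * 1/suc (suc n))   ≡⟨ cong (partialExp (suc n)) (ℚ.*-zeroˡ (1/suc (suc n))) ⟩
    partialExp (suc n) 0ℚ                          ≡⟨ partialExp-0 n ⟩
    1ℚ                                             ≤⟨ 1≤y ⟩
    y                                              ∎)

gridLog-upper : ∀ {n y} → 2 ℕ.≤ n → y ≤ partialExp n (gridLog n y + 1/suc n)
gridLog-upper {n} {y} 2≤n = ℚ.<⇒≤ (ℚ.≰⇒> λ h →
  largest-maximal (gridBelow? n y) J too-far (subst (λ z → partialExp n z ≤ y) next h))
  where
  J = suc n ℕ.* ℤ.∣ ↥ y ∣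
  g = largest (gridBelow? n y) J
  next : fromℕ g * 1/suc n + 1/suc n ≡ fromℕ (suc g) * 1/suc n
  next = trans (solve 2 (λ g h → g :* h :+ h := (con 1ℚ :+ g) :* h) refl (fromℕ g) (1/suc n))
               (cong (_* 1/suc n) (sym (fromℕ-suc g)))
  J/n : fromℕ J * 1/suc n ≡ fromℕ ℤ.∣ ↥ y ∣
  J/n = trans (cong (_* 1/suc n) (fromℕ-* (suc n) ℤ.∣ ↥ y ∣))
    (trans (solve 3 (λ a b c → a :* b :* c := (a :* c) :* b) refl (fromℕ (suc n)) (fromℕ ℤ.∣ ↥ y ∣) (1/suc n))
    (trans (cong (_* fromℕ ℤ.∣ ↥ y ∣) (1/suc-inverse n)) (ℚ.*-identityˡ (fromℕ ℤ.∣ ↥ y ∣))))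
  point : ℚ
  point = fromℕ (suc J) * 1/suc n
  too-far : ¬ (partialExp n point ≤ y)
  too-far h = ℚ.<-irrefl refl (begin-strict
    y                       ≤⟨ ≤-archimedean y ⟩
    fromℕ ℤ.∣ ↥ y ∣         ≡⟨ sym J/n ⟩
    fromℕ J * 1/suc n       ≤⟨ *-≤ʳ (1/suc n) (0≤1/suc n) (fromℕ-mono (ℕ.n≤1+n J)) ⟩
    point                   ≡⟨ sym (ℚ.+-identityʳ point) ⟩
    point + 0ℚ              <⟨ ℚ.+-monoʳ-< point 0<1 ⟩
    point + 1ℚ              ≤⟨ partialExp-growth 2≤n (0≤* (0≤fromℕ (suc J)) (0≤1/suc n)) ⟩
    partialExp n point      ≤⟨ h ⟩
    y                       ∎)

⊔-contracts : ∀ p q r → ∣ (p ⊔ r) - (q ⊔ r) ∣ ≤ ∣ p - q ∣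
⊔-contracts p q r = ∣-∣-intro (half p q ℚ.≤-refl) (half q p (ℚ.≤-reflexive (∣-∣-sym q p)))
  where
  half : ∀ p q {d} → ∣ p - q ∣ ≤ d → p ⊔ r ≤ q ⊔ r + d
  half p q {d} h = ℚ.⊔-lub
    (ℚ.≤-trans (∣-∣-elim {p} {q} h) (ℚ.+-monoˡ-≤ d (ℚ.p≤p⊔q q r)))
    (ℚ.≤-trans (ℚ.p≤q⊔p q r) (p≤p+q (ℚ.≤-trans (ℚ.0≤∣p∣ (p - q)) h)))

logSeq : ℝ → ℕ → ℚ
logSeq x n = gridLog n (seq x n ⊔ 1ℚ)

module LogBounds (x : ℝ) (K₀ N₁ D : ℕ)
  (x≤ : ∀ n → N₁ ℕ.≤ n → ∣ seq x n ∣ ≤ fromℕ (suc K₀))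
  (exp≤ : ∀ n → partialExp n (fromℕ (suc (suc K₀))) ≤ fromℕ (suc D)) where

  K N : ℕ
  K = suc (suc K₀)
  N = 2 ℕ.⊔ N₁

  y l : ℕ → ℚ
  y n = seq x n ⊔ 1ℚ
  l = logSeq x

  1≤y : ∀ n → 1ℚ ≤ y n
  1≤y n = ℚ.p≤q⊔p (seq x n) 1ℚ

  l+1/suc≤K : ∀ {n} → N ℕ.≤ n → l n + 1/suc n ≤ fromℕ K
  l+1/suc≤K {n} N≤n = begin
    l n + 1/suc n                      ≤⟨ +-≤ l≤y (1/suc≤1 n) ⟩
    y n + 1ℚ                           ≤⟨ ℚ.+-monoˡ-≤ 1ℚ y≤ ⟩
    fromℕ (suc K₀) + 1ℚ                ≡⟨ trans (ℚ.+-comm (fromℕ (suc K₀)) 1ℚ) (sym (fromℕ-suc (suc K₀))) ⟩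
    fromℕ K                            ∎
    where
    2≤n : 2 ℕ.≤ n
    2≤n = ℕ.m⊔n≤o⇒m≤o 2 N₁ N≤n
    y≤ : y n ≤ fromℕ (suc K₀)
    y≤ = ℚ.⊔-lub
      (ℚ.≤-trans (p≤∣p∣ (seq x n)) (x≤ n (ℕ.m⊔n≤o⇒n≤o 2 N₁ N≤n)))
      (fromℕ-mono {1} {suc K₀} (ℕ.s≤s ℕ.z≤n))
    l≤y : l n ≤ y n
    l≤y = ℚ.≤-trans (p≤p+q 0≤1)
      (ℚ.≤-trans (partialExp-growth 2≤n (0≤gridLog n (y n))) (gridLog-lower 2≤n (1≤y n)))

  ∣l∣≤K : ∀ {n} → N ℕ.≤ n → ∣ l n ∣ ≤ fromℕ K
  ∣l∣≤K {n} N≤n = ℚ.≤-trans (ℚ.≤-reflexive (ℚ.0≤p⇒∣p∣≡p (0≤gridLog n (y n))))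
    (ℚ.≤-trans (p≤p+q (0≤1/suc n)) (l+1/suc≤K N≤n))

  partialExp-l : ∀ {n} → N ℕ.≤ n → ∣ partialExp n (l n) - y n ∣ ≤ fromℕ (suc D) * 1/suc n
  partialExp-l {n} N≤n = ∣-∣-intro
    (ℚ.≤-trans (gridLog-lower 2≤n (1≤y n)) (p≤p+q (0≤* (0≤fromℕ (suc D)) (0≤1/suc n))))
    (ℚ.≤-trans (gridLog-upper 2≤n) (∣-∣-elim {partialExp n l′} {partialExp n (l n)} (begin
      ∣ partialExp n l′ - partialExp n (l n) ∣
        ≤⟨ partialExp-lipschitz-ℕ K {D} exp≤ n ∣l′∣≤K (∣l∣≤K N≤n) ⟩
      fromℕ (suc D) * ∣ l′ - l n ∣
        ≡⟨ cong (λ z → fromℕ (suc D) * ∣ z ∣) (solve 2 (λ l h → (l :+ h) :- l := h) refl (l n) (1/suc n)) ⟩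
      fromℕ (suc D) * ∣ 1/suc n ∣
        ≡⟨ cong (fromℕ (suc D) *_) (ℚ.0≤p⇒∣p∣≡p (0≤1/suc n)) ⟩
      fromℕ (suc D) * 1/suc n ∎)))
    where
    2≤n : 2 ℕ.≤ n
    2≤n = ℕ.m⊔n≤o⇒m≤o 2 N₁ N≤n
    l′ : ℚ
    l′ = l n + 1/suc n
    ∣l′∣≤K : ∣ l′ ∣ ≤ fromℕ K
    ∣l′∣≤K = ℚ.≤-trans (ℚ.≤-reflexive (ℚ.0≤p⇒∣p∣≡p (0≤+ (0≤gridLog n (y n)) (0≤1/suc n)))) (l+1/suc≤K N≤n)

  error : ℕ → ℕ → ℚ
  error m n = fromℕ (suc D) * 1/suc m

  small-error : Small error
  small-error = small-* {λ m n → 1/suc m} D small-1/suc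

  l-cauchy : Small (λ m n → ∣ l m - l n ∣)
  l-cauchy = small-mono {λ m n → ∣ l m - l n ∣}
    {λ m n → error m n + (∣ seq x m - seq x n ∣ + (error n m + (twice (term n (fromℕ K)) + twice (term m (fromℕ K)))))}
    (N ℕ.⊔ N₀ , λ m n hm hn → bound m n
      (ℕ.m⊔n≤o⇒m≤o N N₀ hm) (ℕ.m⊔n≤o⇒n≤o N N₀ hm) (ℕ.m⊔n≤o⇒m≤o N N₀ hn) (ℕ.m⊔n≤o⇒n≤o N N₀ hn))
    (small-+ {error} {λ m n → ∣ seq x m - seq x n ∣ + (error n m + (twice (term n (fromℕ K)) + twice (term m (fromℕ K))))}
      small-error
      (small-+ {λ m n → ∣ seq x m - seq x n ∣} {λ m n → error n m + (twice (term n (fromℕ K)) + twice (term m (fromℕ K)))}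
        (cauchy x)
        (small-+ {λ m n → error n m} {λ m n → twice (term n (fromℕ K)) + twice (term m (fromℕ K))}
          (small-swap {error} small-error)
          (small-swap {λ m n → twice (term m (fromℕ K)) + twice (term n (fromℕ K))} (small-close K)))))
    where
    N₀ = K ℕ.+ K
    bound : ∀ m n → N ℕ.≤ m → N₀ ℕ.≤ m → N ℕ.≤ n → N₀ ℕ.≤ n →
      ∣ l m - l n ∣ ≤ error m n + (∣ seq x m - seq x n ∣ + (error n m + (twice (term n (fromℕ K)) + twice (term m (fromℕ K)))))
    bound m n hm hm₀ hn hn₀ = begin
      ∣ l m - l n ∣
        ≤⟨ partialExp-expands-∣∣ {m} (ℕ.m⊔n≤o⇒m≤o 2 N₁ hm) (0≤gridLog m (y m)) (0≤gridLog n (y n)) ⟩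
      ∣ partialExp m (l m) - partialExp m (l n) ∣
        ≤⟨ ∣-∣-triangle (partialExp m (l m)) (y m) (partialExp m (l n)) ⟩
      ∣ partialExp m (l m) - y m ∣ + ∣ y m - partialExp m (l n) ∣
        ≤⟨ +-≤ (partialExp-l hm) (ℚ.≤-trans (∣-∣-triangle (y m) (y n) (partialExp m (l n)))
             (+-≤ (⊔-contracts (seq x m) (seq x n) 1ℚ)
               (ℚ.≤-trans (∣-∣-triangle (y n) (partialExp n (l n)) (partialExp m (l n)))
                 (+-≤ (ℚ.≤-trans (ℚ.≤-reflexive (∣-∣-sym (y n) (partialExp n (l n)))) (partialExp-l hn))
                      (partialExp-close K n m (∣l∣≤K hn) hn₀ hm₀))))) ⟩
      error m n + (∣ seq x m - seq x n ∣ + (error n m + (twice (term n (fromℕ K)) + twice (term m (fromℕ K))))) ∎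

  below : fromℕℝ 1 ≤ℝ x → ∀ ε → 0ℚ < ε → ∃ λ N → ∀ n → N ℕ.≤ n → partialExp n (l n) ≤ seq x n + ε
  below 1≤x ε 0<ε =
    let ε/2 = ε * ½
        0<ε/2 = 0<* 0<ε (ℚ.positive⁻¹ ½)
        N₂ , near = small-error ε/2 0<ε/2
        N₃ , 1≤ = 1≤x ε/2 0<ε/2
    in N ℕ.⊔ N₂ ℕ.⊔ N₃ , λ n h →
    let h′ = ℕ.m⊔n≤o⇒m≤o (N ℕ.⊔ N₂) N₃ h
        h₀ = ℕ.m⊔n≤o⇒m≤o N N₂ h′
        h₁ = ℕ.m⊔n≤o⇒n≤o N N₂ h′
        h₂ = ℕ.m⊔n≤o⇒n≤o (N ℕ.⊔ N₂) N₃ h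
    in begin
      partialExp n (l n)        ≤⟨ ∣-∣-elim {partialExp n (l n)} {y n} (ℚ.≤-trans (partialExp-l h₀) (near n n h₁ h₁)) ⟩
      y n + ε * ½               ≤⟨ ℚ.+-monoˡ-≤ (ε * ½) (ℚ.⊔-lub {seq x n + ε * ½} {seq x n} {1ℚ} (p≤p+q {seq x n} {ε * ½} (ℚ.<⇒≤ 0<ε/2)) (1≤ n h₂)) ⟩
      seq x n + ε * ½ + ε * ½   ≡⟨ solve 2 (λ x e → x :+ e :* con ½ :+ e :* con ½ := x :+ e) refl (seq x n) ε ⟩
      seq x n + ε               ∎

  above : ∀ ε → 0ℚ < ε → ∃ λ N → ∀ n → N ℕ.≤ n → seq x n ≤ partialExp n (l n) + ε
  above ε 0<ε =
    let N₂ , near = small-error ε 0<ε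
    in N ℕ.⊔ N₂ , λ n h → begin
      seq x n                   ≤⟨ ℚ.p≤p⊔q (seq x n) 1ℚ ⟩
      y n                       ≤⟨ ∣-∣-elim {y n} {partialExp n (l n)} (ℚ.≤-trans
                                     (ℚ.≤-reflexive (∣-∣-sym (y n) (partialExp n (l n))))
                                     (ℚ.≤-trans (partialExp-l (ℕ.m⊔n≤o⇒m≤o N N₂ h))
                                                (near n n (ℕ.m⊔n≤o⇒n≤o N N₂ h) (ℕ.m⊔n≤o⇒n≤o N N₂ h)))) ⟩
      partialExp n (l n) + ε    ∎

module Log (x : ℝ) = LogBounds x
  (proj₁ (bounded x))
  (proj₁ (proj₂ (bounded x)))
  (proj₁ (partialExp-bounded (suc (suc (proj₁ (bounded x))))))
  (proj₂ (proj₂ (bounded x)))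
  (proj₂ (partialExp-bounded (suc (suc (proj₁ (bounded x))))))

-- log⁺ x = log (max x 1), the natural logarithm on [1 , ∞).
log⁺ : ℝ → ℝ
log⁺ x = real (logSeq x) (Log.l-cauchy x)

exp-log⁺ : ∀ x → fromℕℝ 1 ≤ℝ x → exp (log⁺ x) ≃ℝ x
exp-log⁺ x 1≤x = Log.below x 1≤x , Log.above x

-- Natural base and positive real exponent, so that 0 ^ℝ P = 0.
infixr 8 _^ℝ_

_^ℝ_ : ℕ → ℝ → ℝ
zero  ^ℝ P = fromℕℝ 0
suc n ^ℝ P = exp (P *ℝ log⁺ (fromℕℝ (suc n)))

IsThreshold : (r k : ℕ) (P C : ℝ) → ℕ → Set
IsThreshold r k P C N =
  (G : Graph) → N ℕ.≤ χ G → fromℕℝ (e G) ≤ℝ C *ℝ χ G ^ℝ P →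
  Σ Graph λ H → H ⊑ G × [ r ] ≤⁺ girth H × k ℕ.≤ χ H

-- M = M_{r,k}(P,C).  As χ is integer-valued, the least threshold is sought in ℕ.
-- e(G) ≤ C χ(G)^P is an undecidable inequality of reals, so the existence of M,
-- which is a classical fact, is only available under ¬ ¬.
IsM : (r k : ℕ) (P C : ℝ) → ℕ → Set
IsM r k P C = IsLeast (IsThreshold r k P C)

{-# OPTIONS --safe #-}
module Submission where

-- Let c = k - 1. Edges of G are added greedily to a subgraph H of girth ≥ r and maximum degree ≤ D, while
-- the c-colourings of the vertices that are proper on H are counted. If some edge of G that may still be
-- added is monochromatic in a fraction > 1/Δ of them, adding it shrinks their number by a factor 1 - 1/Δ; should
-- they run out, H has chromatic number ≥ k. Otherwise the edges between vertices of degree < D are of two kinds.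
--   * The ends are joined in H by a walk of length ≤ r - 2. Such pairs are separated by a greedy colouring
--     with about D^r colours.
--   * At most a fraction 1/Δ of the remaining c-colourings is monochromatic on the edge. If e(G) < Δ^N, then
--     N of these colourings, chosen by averaging, separate all such edges, which takes c^N colours.
-- Counting edges of H shows that at most half of the vertices have degree D when D = 4Δc, and the argument is
-- repeated on them with a fresh H. Since G is not coloured by log₂ e(G) rounds of this when Δ = 2^{O(P + log C)}
-- and χ(G) ≥ 2^{O(P + log C)}, some round produces H. As P + log C ≥ 1, this implies the quadratic bound.

open import Defs
open import Data.Nat using (ℕ; _≤_; zero; suc; _+_; _*_; _^_; _∸_; _<_; z≤n; s≤s; _≤?_; _<?_; _⊔_; pred; >-nonZero)
open import Data.Nat.Induction using (<-rec)
open import Data.Nat.ListAction using (sum)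
open import Data.Nat.Properties
open import Data.Nat.Tactic.RingSolver using (solve-∀)
open import Data.Bool using (T)
open import Data.Fin as Fin using (Fin)
import Data.Fin.Properties as Fin
import Data.Integer as ℤ
open import Data.List using (List; []; _∷_; length; map; filter; concatMap; lookup; allFin; cartesianProduct; deduplicate)
open import Data.List.Properties using (length-map; length-++; length-deduplicate; length-tabulate)
import Data.List.Membership.DecPropositional as DecMembership
open import Data.List.Membership.Propositional using (_∈_; _∉_; find; lose)
open import Data.List.Membership.Propositional.Properties
open import Data.List.Relation.Unary.All using (All; []; _∷_)
open import Data.List.Relation.Unary.AllPairs using ([]; _∷_)
open import Data.List.Relation.Unary.Any as Any using (here; there)
open import Data.List.Relation.Unary.Any.Properties using (lookup-index)
open import Data.List.Relation.Unary.Unique.DecPropositional.Properties using (deduplicate-!)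
open import Data.List.Relation.Unary.Unique.Propositional using (Unique)
import Data.List.Relation.Unary.Unique.Propositional.Properties as Unique
open import Data.Product using (Σ; ∃; _×_; _,_; proj₁; proj₂)
open import Data.Product.Properties using (≡-dec)
open import Data.Rational as ℚ using (ℚ; 0ℚ; 1ℚ; ½; ∣_∣; ↥_) renaming (_+_ to _+ℚ_; _*_ to _*ℚ_; _-_ to _-ℚ_; _≤_ to _≤ℚ_)
import Data.Rational.Properties as ℚ
open import Data.Rational.Solver using (module +-*-Solver)
open import Data.Sum using (_⊎_; inj₁; inj₂)
open import Function using (_∘_; mk⇔)
open import Relation.Binary.Construct.Add.Supremum.NonStrict _≤_ using (_≤⁺_; _≤⊤⁺) renaming ([_] to [_]≤)
open import Relation.Binary.Definitions using (DecidableEquality; tri<; tri≈; tri>)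
open import Relation.Binary.PropositionalEquality
open import Relation.Nullary using (¬_; Dec; yes; no; contradiction; ¬?; does; _×-dec_; _⊎-dec_)
open import Relation.Nullary.Construct.Add.Supremum using ([_])
open import Relation.Nullary.Decidable using (does-⇔; dec-false)
open import Relation.Unary using (Decidable)
open +-*-Solver using (solve; _:=_; _:+_; _:*_; _:-_; con)

-- Sums, counts and averages over lists.

indicator : {P : Set} → Dec P → ℕ
indicator (yes _) = 1
indicator (no _)  = 0

∑ : ∀ {A : Set} → List A → (A → ℕ) → ℕ
∑ xs f = sum (map f xs)

count : ∀ {A : Set} {P : A → Set} → Decidable P → List A → ℕ
count P? xs = ∑ xs λ x → indicator (P? x)

∑-0 : ∀ {A : Set} (xs : List A) → ∑ xs (λ _ → 0) ≡ 0
∑-0 []       = refl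
∑-0 (x ∷ xs) = ∑-0 xs

∑-+ : ∀ {A : Set} (xs : List A) (f g : A → ℕ) → ∑ xs (λ x → f x + g x) ≡ ∑ xs f + ∑ xs g
∑-+ []       f g = refl
∑-+ (x ∷ xs) f g rewrite ∑-+ xs f g = rearrange (f x) (g x) (∑ xs f) (∑ xs g)
  where
  rearrange : ∀ a b c d → a + b + (c + d) ≡ a + c + (b + d)
  rearrange = solve-∀

∑-* : ∀ {A : Set} (xs : List A) (f : A → ℕ) (m : ℕ) → ∑ xs (λ x → m * f x) ≡ m * ∑ xs f
∑-* []       f m = sym (*-zeroʳ m)
∑-* (x ∷ xs) f m rewrite ∑-* xs f m = sym (*-distribˡ-+ m (f x) (∑ xs f))

∑-swap : ∀ {A B : Set} (xs : List A) (ys : List B) (f : A → B → ℕ) →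
         ∑ xs (λ x → ∑ ys (f x)) ≡ ∑ ys (λ y → ∑ xs λ x → f x y)
∑-swap []       ys f = sym (∑-0 ys)
∑-swap (x ∷ xs) ys f rewrite ∑-swap xs ys f = sym (∑-+ ys (f x) (λ y → ∑ xs λ x → f x y))

∑-≤ : ∀ {A : Set} (xs : List A) (f : A → ℕ) (b : ℕ) → (∀ {x} → x ∈ xs → f x ≤ b) → ∑ xs f ≤ length xs * b
∑-≤ []       f b f≤b = z≤n
∑-≤ (x ∷ xs) f b f≤b = +-mono-≤ (f≤b (here refl)) (∑-≤ xs f b λ p → f≤b (there p))

∑-≥ : ∀ {A : Set} (xs : List A) (f : A → ℕ) (b : ℕ) → (∀ {x} → x ∈ xs → b ≤ f x) → length xs * b ≤ ∑ xs f
∑-≥ []       f b b≤f = z≤n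
∑-≥ (x ∷ xs) f b b≤f = +-mono-≤ (b≤f (here refl)) (∑-≥ xs f b λ p → b≤f (there p))

∃-≤-average : ∀ {A : Set} (xs : List A) (f : A → ℕ) (b : ℕ) → 1 ≤ length xs →
              ∑ xs f ≤ length xs * b → ∃ λ x → x ∈ xs × f x ≤ b
∃-≤-average (x ∷ xs) f b _ h with f x ≤? b
... | yes fx≤b = x , here refl , fx≤b
∃-≤-average (x ∷ []) f b _ h | no fx≰b =
  contradiction (subst₂ _≤_ (+-identityʳ (f x)) (+-identityʳ b) h) fx≰b
∃-≤-average (x ∷ xs@(_ ∷ _)) f b _ h | no fx≰b =
  let y , y∈ , fy≤b = ∃-≤-average xs f b (s≤s z≤n)
        (+-cancelˡ-≤ b (∑ xs f) (length xs * b)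
          (≤-trans (+-monoˡ-≤ (∑ xs f) (<⇒≤ (≰⇒> fx≰b))) h))
  in y , there y∈ , fy≤b

length-filter≡count : ∀ {A : Set} {P : A → Set} (P? : Decidable P) (xs : List A) → length (filter P? xs) ≡ count P? xs
length-filter≡count P? []       = refl
length-filter≡count P? (x ∷ xs) with P? x
... | yes _ = cong suc (length-filter≡count P? xs)
... | no _  = length-filter≡count P? xs

count+filter-¬ : ∀ {A : Set} {P : A → Set} (P? : Decidable P) (xs : List A) →
                 count P? xs + length (filter (λ x → ¬? (P? x)) xs) ≡ length xs
count+filter-¬ P? []       = refl
count+filter-¬ P? (x ∷ xs) with P? x
... | yes _ = cong suc (count+filter-¬ P? xs)
... | no _  = trans (+-suc _ _) (cong suc (count+filter-¬ P? xs))

count-∉ : ∀ {A : Set} (_≟_ : DecidableEquality A) {a : A} {xs : List A} → All (a ≢_) xs → count (a ≟_) xs ≡ 0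
count-∉ _≟_ []          = refl
count-∉ _≟_ {a} {x ∷ xs} (a≢x ∷ a∉) with a ≟ x
... | yes a≡x = contradiction a≡x a≢x
... | no _    = count-∉ _≟_ a∉

count-unique : ∀ {A : Set} (_≟_ : DecidableEquality A) {a : A} {xs : List A} → Unique xs → count (a ≟_) xs ≤ 1
count-unique _≟_ []           = z≤n
count-unique _≟_ {a} {x ∷ xs} (x∉ ∷ u) with a ≟ x
... | yes refl = s≤s (≤-reflexive (count-∉ _≟_ x∉))
... | no _     = count-unique _≟_ u

-- Every c-colouring is counted with the pairs it fails to separate; an average colouring
-- fails on few pairs, and N of them together fail on none.
separating-colouring : ∀ {V : Set} {c} (L : List (V → Fin c)) (D : ℕ) → 1 ≤ length L →
  ∀ N (E : List (V × V)) →
  (∀ {a} → a ∈ E → D * count (λ f → f (proj₁ a) Fin.≟ f (proj₂ a)) L ≤ length L) →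
  length E < D ^ N →
  Σ (V → Fin (c ^ N)) λ ψ → ∀ u v → (u , v) ∈ E → ψ u ≢ ψ v
separating-colouring L D 1≤L zero    []      rare (s≤s z≤n) = (λ _ → Fin.zero) , λ _ _ ()
separating-colouring L D 1≤L zero    (_ ∷ _) rare (s≤s ())
separating-colouring {V} L D 1≤L (suc N) E rare E< =
  combine-with (∃-≤-average L (λ f → D * count (mono f) E) (length E) 1≤L average)
  where
  open ≤-Reasoning
  mono : ∀ {c} (f : V → Fin c) (a : V × V) → Dec (f (proj₁ a) ≡ f (proj₂ a))
  mono f a = f (proj₁ a) Fin.≟ f (proj₂ a)
  average : ∑ L (λ f → D * count (mono f) E) ≤ length L * length E
  average = begin
    ∑ L (λ f → D * count (mono f) E)                 ≡⟨ ∑-* L (λ f → count (mono f) E) D ⟩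
    D * ∑ L (λ f → count (mono f) E)                 ≡⟨ cong (D *_) (∑-swap L E (λ f a → indicator (mono f a))) ⟩
    D * ∑ E (λ a → count (λ f → mono f a) L)         ≡⟨ sym (∑-* E (λ a → count (λ f → mono f a) L) D) ⟩
    ∑ E (λ a → D * count (λ f → mono f a) L)         ≤⟨ ∑-≤ E _ (length L) rare ⟩
    length E * length L                              ≡⟨ *-comm (length E) (length L) ⟩
    length L * length E                              ∎
  combine-with : (∃ λ f → f ∈ L × D * count (mono f) E ≤ length E) → _
  combine-with (f , _ , few) = (λ v → Fin.combine (f v) (proj₁ rest v)) , separated
    where
    -- Only the pairs on which `f` fails are passed on, and the choice of `f` has divided their
    -- number by at least `D`. At exponent 0 there is fewer than one pair left.
    E′ = filter (mono f) E
    E′< : length E′ < D ^ N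
    E′< = *-cancelˡ-< D (length E′) (D ^ N) (begin-strict
      D * length E′         ≡⟨ cong (D *_) (length-filter≡count (mono f) E) ⟩
      D * count (mono f) E  ≤⟨ few ⟩
      length E              <⟨ E< ⟩
      D * D ^ N             ∎)
    rest = separating-colouring L D 1≤L N E′ (λ p → rare (proj₁ (∈-filter⁻ (mono f) p))) E′<
    separated : ∀ u v → (u , v) ∈ E → Fin.combine (f u) (proj₁ rest u) ≢ Fin.combine (f v) (proj₁ rest v)
    separated u v p eq = let fu≡fv , ψu≡ψv = Fin.combine-injective _ _ _ _ eq
      in proj₂ rest u v (∈-filter⁺ (mono f) p fu≡fv) ψu≡ψv

-- Greedy colouring.

length-concatMap-≤ : ∀ {A B : Set} (f : A → List B) b → (∀ x → length (f x) ≤ b) →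
                     ∀ xs → length (concatMap f xs) ≤ length xs * b
length-concatMap-≤ f b f≤ []       = z≤n
length-concatMap-≤ f b f≤ (x ∷ xs) = ≤-trans (≤-reflexive (length-++ (f x)))
  (+-mono-≤ (f≤ x) (length-concatMap-≤ f b f≤ xs))

-- Pigeonhole: if every colour occurred, their positions would inject `suc s` colours into a list of
-- length at most `s`.
fresh : ∀ {s} (xs : List (Fin (suc s))) → length xs ≤ s → ∃ λ c → c ∉ xs
fresh {s} xs short = Fin.¬∀⟶∃¬ (suc s) (_∈ xs) (_∈? xs) λ all∈ →
  1+n≰n (≤-trans (Fin.injective⇒≤ {f = λ c → Any.index (all∈ c)} λ {c} {d} eq →
    trans (lookup-index (all∈ c)) (trans (cong (lookup xs) eq) (sym (lookup-index (all∈ d))))) short)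
  where open DecMembership Fin._≟_ using (_∈?_)

-- Vertices are coloured one at a time, each avoiding the current colours of its whole list `nb`.
-- The clause `u ≢ v` is there because the relation of interest, `Walk H i`, is reflexive.
greedy-colouring : ∀ {n s} (R : Fin n → Fin n → Set) → (∀ {u v} → R u v → R v u) →
  (nb : Fin n → List (Fin n)) → (∀ u → length (nb u) ≤ s) → (∀ {u v} → R u v → v ∈ nb u) →
  Σ (Fin n → Fin (suc s)) λ z → ∀ u v → u ≢ v → R u v → z u ≢ z v
greedy-colouring {n} {s} R R-sym nb nb≤ R⇒nb =
  let z , proper = colour (allFin n) in z , λ u v → proper (∈-allFin u) (∈-allFin v)
  where
  colour : ∀ xs → Σ (Fin n → Fin (suc s)) λ z →
           ∀ {u v} → u ∈ xs → v ∈ xs → u ≢ v → R u v → z u ≢ z v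
  colour []       = (λ _ → Fin.zero) , λ ()
  colour (x ∷ xs) = z′ , proper′
    where
    z = proj₁ (colour xs)
    proper = proj₂ (colour xs)
    new = fresh (map z (nb x)) (subst (_≤ s) (sym (length-map z (nb x))) (nb≤ x))
    z′ : Fin n → Fin (suc s)
    z′ v with v Fin.≟ x
    ... | yes _ = proj₁ new
    ... | no _  = z v
    old : ∀ {v} → v ∈ x ∷ xs → v ≢ x → v ∈ xs
    old (here v≡x) v≢x = contradiction v≡x v≢x
    old (there v∈) _   = v∈
    avoid : ∀ {v} → R x v → proj₁ new ≢ z v
    avoid xRv eq = proj₂ new (subst (_∈ map z (nb x)) (sym eq) (∈-map⁺ z (R⇒nb xRv)))
    proper′ : ∀ {u v} → u ∈ x ∷ xs → v ∈ x ∷ xs → u ≢ v → R u v → z′ u ≢ z′ v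
    proper′ {u} {v} u∈ v∈ u≢v uRv with u Fin.≟ x | v Fin.≟ x
    ... | yes refl | yes refl = contradiction refl u≢v
    ... | yes refl | no _     = avoid uRv
    ... | no _     | yes refl = avoid (R-sym uRv) ∘ sym
    ... | no u≢x   | no v≢x   = proper (old u∈ u≢x) (old v∈ v≢x) u≢v uRv

-- Arcs, walks and cycles

-- A graph on V is given here by the list of its arcs, each edge occurring in both directions.
Arcs : Set → Set
Arcs V = List (V × V)

module _ {V : Set} where

  Symmetricᴬ : Arcs V → Set
  Symmetricᴬ H = ∀ {u v} → (u , v) ∈ H → (v , u) ∈ H

  infixr 5 _∷_

  -- Walks of length at most i.
  data Walk (H : Arcs V) : ℕ → V → V → Set where
    []  : ∀ {i u} → Walk H i u u
    _∷_ : ∀ {i u v w} → (u , v) ∈ H → Walk H i v w → Walk H (suc i) u w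

  walk-weaken : ∀ {H i j u v} → i ≤ j → Walk H i u v → Walk H j u v
  walk-weaken i≤j       []      = []
  walk-weaken (s≤s i≤j) (a ∷ w) = a ∷ walk-weaken i≤j w

  walk-++ : ∀ {H i j u v w} → Walk H i u v → Walk H j v w → Walk H (i + j) u w
  walk-++ {i = i} {j} [] w₂ = walk-weaken (m≤n+m j i) w₂
  walk-++ (a ∷ w₁) w₂       = a ∷ walk-++ w₁ w₂

  walk-reverse : ∀ {H i u v} → Symmetricᴬ H → Walk H i u v → Walk H i v u
  walk-reverse H-sym [] = []
  walk-reverse {i = suc i} H-sym (a ∷ w) =
    walk-weaken (≤-reflexive (+-comm i 1)) (walk-++ (walk-reverse H-sym w) (H-sym a ∷ []))

  walk-along : ∀ {H} (p : ℕ → V) a m → (∀ t → a ≤ t → t < a + m → (p t , p (suc t)) ∈ H) →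
               Walk H m (p a) (p (a + m))
  walk-along {H} p a zero    arcs = subst (λ b → Walk H 0 (p a) (p b)) (sym (+-identityʳ a)) []
  walk-along {H} p a (suc m) arcs = arcs a ≤-refl (m<m+n a (s≤s z≤n)) ∷
    subst (λ b → Walk H m (p (suc a)) (p b)) (sym (+-suc a m))
      (walk-along p (suc a) m λ t a<t t< → arcs t (<⇒≤ a<t) (subst (t <_) (sym (+-suc a m)) t<))

  -- The length is `l + 1`. Indexing by ℕ rather than by `Fin (suc l)` lets `walk-along` cut
  -- segments out of the cycle.
  record Cycle (H : Arcs V) (l : ℕ) (p : ℕ → V) : Set where
    field
      2≤l       : 2 ≤ l
      injective : ∀ {s t} → s ≤ l → t ≤ l → p s ≡ p t → s ≡ t
      arcs      : ∀ {t} → t < l → (p t , p (suc t)) ∈ H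
      closing   : (p l , p 0) ∈ H

  -- No cycles of length at most i + 1.
  NoShortCycle : ℕ → Arcs V → Set
  NoShortCycle i H = ∀ {l p} → l ≤ i → ¬ Cycle H l p

addEdge : ∀ {V : Set} → V → V → Arcs V → Arcs V
addEdge a b H = (a , b) ∷ (b , a) ∷ H

addEdge-symmetric : ∀ {V : Set} {a b : V} {H} → Symmetricᴬ H → Symmetricᴬ (addEdge a b H)
addEdge-symmetric H-sym (here refl)          = there (here refl)
addEdge-symmetric H-sym (there (here refl))  = here refl
addEdge-symmetric H-sym (there (there p))    = there (there (H-sym p))

module _ {n : ℕ} where

  private
    V = Fin n

  -- A short cycle through the new edge would leave a short walk between its ends.
  addEdge-noShortCycle : ∀ {i} {a b : V} {H} → Symmetricᴬ H → ¬ Walk H i a b →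
    NoShortCycle i H → NoShortCycle i (addEdge a b H)
  addEdge-noShortCycle {i} {a} {b} {H} H-sym ¬walk noShort {l} {p} l≤i cycle =
    through (anyUpTo? (λ t → new? (p t) (p (suc t))) l)
    where
    open Cycle cycle
    New : V → V → Set
    New u v = (u ≡ a × v ≡ b) ⊎ (u ≡ b × v ≡ a)
    new? : ∀ u v → Dec (New u v)
    new? u v = (u Fin.≟ a ×-dec v Fin.≟ b) ⊎-dec (u Fin.≟ b ×-dec v Fin.≟ a)
    old : ∀ {u v} → ¬ New u v → (u , v) ∈ addEdge a b H → (u , v) ∈ H
    old ¬new (here refl)         = contradiction (inj₁ (refl , refl)) ¬new
    old ¬new (there (here refl)) = contradiction (inj₂ (refl , refl)) ¬new
    old ¬new (there (there q))   = q
    ¬walk-New : ∀ {u v} → New u v → ¬ Walk H i u v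
    ¬walk-New (inj₁ (refl , refl)) w = ¬walk w
    ¬walk-New (inj₂ (refl , refl)) w = ¬walk (walk-reverse H-sym w)
    same-ends : ∀ {u v u′ v′} → New u v → New u′ v′ → (u ≡ u′ × v ≡ v′) ⊎ (u ≡ v′ × v ≡ u′)
    same-ends (inj₁ (refl , refl)) (inj₁ (refl , refl)) = inj₁ (refl , refl)
    same-ends (inj₁ (refl , refl)) (inj₂ (refl , refl)) = inj₂ (refl , refl)
    same-ends (inj₂ (refl , refl)) (inj₁ (refl , refl)) = inj₂ (refl , refl)
    same-ends (inj₂ (refl , refl)) (inj₂ (refl , refl)) = inj₁ (refl , refl)
    no-chord : ∀ {t} → t < l → New (p t) (p (suc t)) → ¬ New (p l) (p 0)
    no-chord t<l new closing-new with same-ends new closing-new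
    ... | inj₁ (eq , _) = <⇒≢ t<l (injective (<⇒≤ t<l) ≤-refl eq)
    -- If the closing arc is the same edge traversed backwards, then `t = 0` and so `l = 1`, against
    -- `2 ≤ l`.
    ... | inj₂ (eq₀ , eqₗ) with injective (<⇒≤ t<l) z≤n eq₀
    ...   | refl = <⇒≢ 2≤l (injective t<l ≤-refl eqₗ)
    new-once : ∀ {s t} → s < l → t < l → New (p s) (p (suc s)) → New (p t) (p (suc t)) → s ≡ t
    new-once s<l t<l new new′ with same-ends new new′
    ... | inj₁ (eq , _) = injective (<⇒≤ s<l) (<⇒≤ t<l) eq
    -- Opposite traversals would give both `s = t + 1` and `t = s + 1`.
    ... | inj₂ (eq , eq′) = contradiction
      (trans (injective (<⇒≤ s<l) t<l eq) (cong suc (sym (injective s<l (<⇒≤ t<l) eq′))))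
      (λ s≡2+s → m≢1+m+n _ {1} (trans s≡2+s (cong suc (+-comm 1 _))))
    through : Dec (∃ λ t → t < l × New (p t) (p (suc t))) → _
    through (no ¬new) with new? (p l) (p 0)
    ... | yes new = ¬walk-New new (walk-reverse H-sym (walk-weaken l≤i
          (walk-along p 0 l λ t _ t<l → old (λ new′ → no-chord t<l new′ new) (arcs t<l))))
    ... | no ¬new₀ = noShort l≤i record
          { 2≤l = 2≤l ; injective = injective
          ; arcs = λ t<l → old (λ new → ¬new (_ , t<l , new)) (arcs t<l)
          ; closing = old ¬new₀ closing }
    -- The rest of the cycle runs from `p (t + 1)` to `p l`, over the closing arc to `p 0` and on to
    -- `p t`. These are `(l - t - 1) + 1 + t = l` arcs, all of them old.
    through (yes (t , t<l , new)) = ¬walk-New new (walk-reverse H-sym (walk-weaken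
        (≤-trans (≤-reflexive length≡l) l≤i) (walk-++ after (old (no-chord t<l new) closing ∷ before))))
      where
      m = l ∸ suc t
      t+m≡l : suc t + m ≡ l
      t+m≡l = m+[n∸m]≡n t<l
      length≡l : m + suc t ≡ l
      length≡l = trans (+-comm m (suc t)) t+m≡l
      other : ∀ s → s < l → s ≢ t → (p s , p (suc s)) ∈ H
      other s s<l s≢t = old (λ new′ → s≢t (new-once s<l t<l new′ new)) (arcs s<l)
      after : Walk H m (p (suc t)) (p l)
      after = subst (λ b → Walk H m (p (suc t)) (p b)) t+m≡l
        (walk-along p (suc t) m λ s t<s s< → other s (subst (s <_) t+m≡l s<) (>⇒≢ t<s))
      before : Walk H t (p 0) (p t)
      before = walk-along p 0 t λ s _ s<t → other s (<-trans s<t t<l) (<⇒≢ s<t)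

  out? : (u : V) (a : V × V) → Dec (proj₁ a ≡ u)
  out? u a = proj₁ a Fin.≟ u

  degree : Arcs V → V → ℕ
  degree H u = count (out? u) H

  neighbours : Arcs V → V → List V
  neighbours H u = map proj₂ (filter (out? u) H)

  -- A list, possibly with repetitions, that makes the existence of a `Walk H i` decidable and whose
  -- length bounds the palette of the greedy colouring.
  ball : Arcs V → ℕ → V → List V
  ball H zero    u = u ∷ []
  ball H (suc i) u = u ∷ concatMap (ball H i) (neighbours H u)

  ball⁺ : ∀ {H i u v} → Walk H i u v → v ∈ ball H i u
  ball⁺ {i = zero}  []      = here refl
  ball⁺ {i = suc i} []      = here refl
  ball⁺ {H} {suc i} {u} (_∷_ {v = w} a walk) =
    there (∈-concatMap⁺ (ball H i) (lose (∈-map⁺ proj₂ (∈-filter⁺ (out? u) a refl)) (ball⁺ walk)))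

  ball⁻ : ∀ {H} i {u v} → v ∈ ball H i u → Walk H i u v
  ball⁻ zero    (here refl) = []
  ball⁻ (suc i) (here refl) = []
  ball⁻ {H} (suc i) {u} (there v∈) with find (∈-concatMap⁻ (ball H i) {xs = neighbours H u} v∈)
  ... | w , w∈ , v∈ball with ∈-map⁻ proj₂ w∈
  ...   | (_ , _) , a∈ , refl with ∈-filter⁻ (out? u) {xs = H} a∈
  ...     | a∈H , refl = a∈H ∷ ball⁻ i v∈ball

  length-ball : ∀ {H D} → (∀ u → degree H u ≤ D) → ∀ i u → length (ball H i u) ≤ suc D ^ i
  length-ball {H} {D} deg≤ zero    u = ≤-refl
  length-ball {H} {D} deg≤ (suc i) u = begin
    suc (length (concatMap (ball H i) (neighbours H u)))
      ≤⟨ s≤s (length-concatMap-≤ (ball H i) (suc D ^ i) (length-ball deg≤ i) (neighbours H u)) ⟩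
    suc (length (neighbours H u) * suc D ^ i)
      ≡⟨ cong (λ m → suc (m * suc D ^ i)) (trans (length-map proj₂ (filter (out? u) H)) (length-filter≡count (out? u) H)) ⟩
    suc (degree H u * suc D ^ i)
      ≤⟨ +-mono-≤ (m^n>0 (suc D) i) (*-monoˡ-≤ (suc D ^ i) (deg≤ u)) ⟩
    suc D ^ i + D * suc D ^ i ∎
    where open ≤-Reasoning

-- Exponential inequalities over the natural numbers.

suc≤2^ : ∀ n → suc n ≤ 2 ^ n
suc≤2^ zero    = ≤-refl
suc≤2^ (suc n) = ≤-trans (+-mono-≤ (m^n>0 2 n) (suc≤2^ n))
  (≤-reflexive (cong (2 ^ n +_) (sym (+-identityʳ (2 ^ n)))))

^-≤-2^ : ∀ m n → m ^ n ≤ 2 ^ (m * n)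
^-≤-2^ m n = ≤-trans (^-monoˡ-≤ n (<⇒≤ (suc≤2^ m))) (≤-reflexive (^-*-assoc 2 m n))

-- Bernoulli's inequality for `(1 + 1/d)^(q+1)`, cleared of denominators. The induction step drops
-- the term `(q+1) d^q`.
bernoulli : ∀ d q → d ^ suc q + suc q * d ^ q ≤ suc d ^ suc q
bernoulli d zero    = ≤-reflexive (identity d)
  where
  identity : ∀ d → d * 1 + 1 ≡ (1 + d) * 1
  identity = solve-∀
bernoulli d (suc q) = ≤-trans
  (≤-trans (m≤m+n _ (suc q * d ^ q)) (≤-reflexive (identity d (d ^ q) q)))
  (*-monoʳ-≤ (suc d) (bernoulli d q))
  where
  identity : ∀ d x q → d * (d * x) + (2 + q) * (d * x) + (1 + q) * x ≡ (1 + d) * (d * x + (1 + q) * x)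
  identity = solve-∀

-- Bernoulli with exponent `d + 1`: after `d + 1` multiplications by `1 - 1/(d+1)` a quantity is at
-- least halved.
2*d^1+d≤ : ∀ d → 2 * d ^ suc d ≤ suc d ^ suc d
2*d^1+d≤ d = ≤-trans
  (≤-trans (≤-reflexive (cong (d ^ suc d +_) (+-identityʳ (d ^ suc d)))) (+-monoʳ-≤ (d ^ suc d) (m≤n+m (d ^ suc d) (d ^ d))))
  (bernoulli d d)

^-distribʳ-* : ∀ s m n → (m * n) ^ s ≡ m ^ s * n ^ s
^-distribʳ-* zero    m n = refl
^-distribʳ-* (suc s) m n rewrite ^-distribʳ-* s m n = identity m n (m ^ s) (n ^ s)
  where
  identity : ∀ m n x y → m * n * (x * y) ≡ m * x * (n * y)
  identity = solve-∀

2^*d^≤ : ∀ d s → 2 ^ s * d ^ (suc d * s) ≤ suc d ^ (suc d * s)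
2^*d^≤ d s = begin
  2 ^ s * d ^ (suc d * s)       ≡⟨ cong (2 ^ s *_) (sym (^-*-assoc d (suc d) s)) ⟩
  2 ^ s * (d ^ suc d) ^ s       ≡⟨ sym (^-distribʳ-* s 2 (d ^ suc d)) ⟩
  (2 * d ^ suc d) ^ s           ≤⟨ ^-monoˡ-≤ s (2*d^1+d≤ d) ⟩
  (suc d ^ suc d) ^ s           ≡⟨ ^-*-assoc (suc d) (suc d) s ⟩
  suc d ^ (suc d * s)           ∎
  where open ≤-Reasoning

-- The hypothesis says c^-n ≤ (1 - 1/(d+1))^t.
steps-bound : ∀ c d n t → suc d ^ t ≤ c ^ n * d ^ t → t ≤ suc d * (c * n)
steps-bound c d n t h = ≮⇒≥ λ s<t → <-irrefl refl (too-many (t ∸ suc s) (m+[n∸m]≡n s<t))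
  where
  open ≤-Reasoning
  s = suc d * (c * n)
  -- Since `c^n ≤ 2^(cn)`, the first `s` steps already use up the factor `c^n`, and any further step
  -- makes the inequality strict.
  too-many : ∀ u → suc s + u ≡ t → suc d ^ t < suc d ^ t
  too-many u eq = begin-strict
    suc d ^ t                               ≤⟨ h ⟩
    c ^ n * d ^ t                           ≤⟨ *-monoˡ-≤ (d ^ t) (^-≤-2^ c n) ⟩
    2 ^ (c * n) * d ^ t                     ≡⟨ cong (λ t → 2 ^ (c * n) * d ^ t) t≡ ⟩
    2 ^ (c * n) * d ^ (s + suc u)           ≡⟨ cong (2 ^ (c * n) *_) (^-distribˡ-+-* d s (suc u)) ⟩
    2 ^ (c * n) * (d ^ s * d ^ suc u)       ≡⟨ sym (*-assoc (2 ^ (c * n)) (d ^ s) (d ^ suc u)) ⟩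
    2 ^ (c * n) * d ^ s * d ^ suc u         ≤⟨ *-monoˡ-≤ (d ^ suc u) (2^*d^≤ d (c * n)) ⟩
    suc d ^ s * d ^ suc u                   <⟨ *-monoʳ-< (suc d ^ s) {{m^n≢0 (suc d) s}} (^-monoˡ-< (suc u) (n<1+n d)) ⟩
    suc d ^ s * suc d ^ suc u               ≡⟨ sym (^-distribˡ-+-* (suc d) s (suc u)) ⟩
    suc d ^ (s + suc u)                     ≡⟨ cong (suc d ^_) (sym t≡) ⟩
    suc d ^ t                               ∎
    where
    t≡ : t ≡ s + suc u
    t≡ = trans (sym eq) (sym (+-suc s u))

-- The greedy process

module _ {n c : ℕ} where

  recolour : (Fin n → Fin c) → Fin n → Fin c → Fin n → Fin c
  recolour g w a v with v Fin.≟ w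
  ... | yes _ = a
  ... | no _  = g v

-- Colourings of `ws` are represented by functions on all vertices that are zero off `ws`, so that
-- their number is governed by `length ws` and not by `n`.
colouringsOn : ∀ {n} c → List (Fin n) → List (Fin n → Fin (suc c))
colouringsOn c []       = (λ _ → Fin.zero) ∷ []
colouringsOn c (w ∷ ws) = concatMap (λ g → map (recolour g w) (allFin (suc c))) (colouringsOn c ws)

length-colouringsOn : ∀ {n} c (ws : List (Fin n)) → length (colouringsOn c ws) ≤ suc c ^ length ws
length-colouringsOn c []       = ≤-refl
length-colouringsOn c (w ∷ ws) = begin
  length (colouringsOn c (w ∷ ws))
    ≤⟨ length-concatMap-≤ (λ g → map (recolour g w) (allFin (suc c))) (suc c)
         (λ g → ≤-reflexive (trans (length-map (recolour g w) (allFin (suc c))) (length-tabulate (λ x → x))))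
         (colouringsOn c ws) ⟩
  length (colouringsOn c ws) * suc c      ≤⟨ *-monoˡ-≤ (suc c) (length-colouringsOn c ws) ⟩
  suc c ^ length ws * suc c               ≡⟨ *-comm (suc c ^ length ws) (suc c) ⟩
  suc c * suc c ^ length ws               ∎
  where open ≤-Reasoning

colouringsOn-complete : ∀ {n} c (ws : List (Fin n)) (f : Fin n → Fin (suc c)) →
  ∃ λ g → g ∈ colouringsOn c ws × (∀ {w} → w ∈ ws → g w ≡ f w)
colouringsOn-complete c []       f = (λ _ → Fin.zero) , here refl , λ ()
colouringsOn-complete c (w ∷ ws) f with colouringsOn-complete c ws f
... | g , g∈ , agree = recolour g w (f w)
    , ∈-concatMap⁺ (λ g → map (recolour g w) (allFin (suc c))) (lose g∈ (∈-map⁺ (recolour g w) (∈-allFin (f w))))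
    , agree′
  where
  agree′ : ∀ {v} → v ∈ w ∷ ws → recolour g w (f w) v ≡ f v
  agree′ {v} v∈ with v Fin.≟ w
  agree′ v∈          | yes refl = refl
  agree′ (here v≡w)  | no v≢w   = contradiction v≡w v≢w
  agree′ (there v∈)  | no _     = agree v∈

module _ {n : ℕ} where

  -- Arcs are counted by their tails; as `F` has no repetitions, each arc is counted at most once.
  degree-sum : (H : Arcs (Fin n)) {F : List (Fin n)} {D : ℕ} → Unique F →
               (∀ {w} → w ∈ F → D ≤ degree H w) → length F * D ≤ length H
  degree-sum H {F} {D} unique D≤ = begin
    length F * D                                        ≤⟨ ∑-≥ F (degree H) D D≤ ⟩
    ∑ F (λ w → count (out? w) H)                        ≡⟨ ∑-swap F H (λ w a → indicator (out? w a)) ⟩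
    ∑ H (λ a → count (proj₁ a Fin.≟_) F)                ≤⟨ ∑-≤ H _ 1 (λ _ → count-unique Fin._≟_ unique) ⟩
    length H * 1                                        ≡⟨ *-identityʳ (length H) ⟩
    length H                                            ∎
    where open ≤-Reasoning

  degree-addEdge : ∀ {D} {a b : Fin n} {H} → a ≢ b → degree H a < D → degree H b < D →
                   (∀ u → degree H u ≤ D) → ∀ u → degree (addEdge a b H) u ≤ D
  degree-addEdge {a = a} {b} a≢b a< b< deg≤ u with a Fin.≟ u | b Fin.≟ u
  ... | yes refl | yes refl = contradiction refl a≢b
  ... | yes refl | no _     = a<
  ... | no _     | yes refl = b<
  ... | no _     | no _     = deg≤ u

Proper : ∀ {V : Set} {c} → Arcs V → (V → Fin c) → Set
Proper H f = ∀ {u v} → (u , v) ∈ H → f u ≢ f v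

-- Here Δ = d + 1 and r = i + 2; a round of the argument uses y colours.
module Process (G : Graph) (i c′ d N : ℕ) (e< : e G < suc d ^ N) where

  open Graph G using (Adj; adj?; loopless; symmetric) renaming (order to n)
  open DecMembership (Fin._≟_ {n}) using (_∈?_)

  private
    V = Fin n
    c = suc c′

  -- `D` is the degree cap and `z` bounds the balls of radius `i`. In `y`, the factor `c ^ N` serves
  -- the rare edges and `suc z` the pairs joined by short walks. In the 4 of `D`, one factor 2 is
  -- for the two arcs of an edge and one for halving the vertex set.
  D z y : ℕ
  D = 4 * (suc d * c)
  z = suc D ^ i
  y = c ^ N * suc z

  Adj⇒≢ : ∀ {u v} → Adj u v → u ≢ v
  Adj⇒≢ {u} uv refl = subst T (loopless u) uv

  Adj-sym : ∀ {u v} → Adj u v → Adj v u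
  Adj-sym {u} {v} = subst T (symmetric u v)

  Adj⇒edge : ∀ {u v} → Adj u v → (u , v) ∈ edges G ⊎ (v , u) ∈ edges G
  Adj⇒edge {u} {v} uv with Fin.<-cmp u v
  ... | tri< u<v _ _ = inj₁ (∈-filter⁺ _ (∈-cartesianProduct⁺ (∈-allFin u) (∈-allFin v)) (u<v , uv))
  ... | tri≈ _ u≡v _ = contradiction u≡v (Adj⇒≢ uv)
  ... | tri> _ _ v<u = inj₂ (∈-filter⁺ _ (∈-cartesianProduct⁺ (∈-allFin v) (∈-allFin u)) (v<u , Adj-sym uv))

  edge⇒Adj : ∀ {u v} → (u , v) ∈ edges G → Adj u v
  edge⇒Adj p = proj₂ (proj₂ (∈-filter⁻ (λ (u , v) → (u Fin.<? v) ×-dec adj? u v) {xs = cartesianProduct (allFin n) (allFin n)} p))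

  record Sparse (H : Arcs V) : Set where
    field
      H⊆G     : ∀ {u v} → (u , v) ∈ H → Adj u v
      H-sym   : Symmetricᴬ H
      noShort : NoShortCycle i H

  Goal : Set
  Goal = ∃ λ H → Sparse H × (∀ (f : V → Fin c) → ¬ Proper H f)

  -- After `t` added edges, `L` represents on `ws` every colouring that is proper on `H`, and `few`
  -- is the bound `c^|ws| (1 - 1/Δ)^t` on its length, written without division.
  record State (ws : List V) : Set where
    field
      H        : Arcs V
      L        : List (V → Fin c)
      t        : ℕ
      sparse   : Sparse H
      degree≤D : ∀ u → degree H u ≤ D
      length-H : length H ≡ 2 * t
      complete : ∀ (f : V → Fin c) → Proper H f → ∃ λ g → g ∈ L × (∀ {w} → w ∈ ws → g w ≡ f w)
      few      : length L * suc d ^ t ≤ c ^ length ws * d ^ t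

  initial : ∀ ws → State ws
  initial ws = record
    { H = [] ; L = colouringsOn c′ ws ; t = 0
    ; sparse = record { H⊆G = λ () ; H-sym = λ () ; noShort = λ _ cycle → noCycle cycle }
    ; degree≤D = λ _ → z≤n ; length-H = refl
    ; complete = λ f _ → colouringsOn-complete c′ ws f
    ; few = *-monoˡ-≤ 1 (length-colouringsOn c′ ws) }
    where
    noCycle : ∀ {l p} → ¬ Cycle [] l p
    noCycle record { closing = () }

  mono? : (a : V × V) (f : V → Fin c) → Dec (f (proj₁ a) ≡ f (proj₂ a))
  mono? a f = f (proj₁ a) Fin.≟ f (proj₂ a)

  module _ {ws : List V} (st : State ws) where
    open State st
    open Sparse sparse

    Frequent : V × V → Set
    Frequent a = length L < suc d * count (mono? a) L

    -- Both ends lie in `ws` because `complete` controls colours only there. The ball condition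
    -- excludes walks of length at most `i = r - 2`, hence new cycles shorter than `r`.
    Available : V × V → Set
    Available (u , v) = (u ∈ ws × v ∈ ws) × (degree H u < D × degree H v < D) × v ∉ ball H i u × Frequent (u , v)

    available? : Decidable Available
    available? (u , v) = (u ∈? ws ×-dec v ∈? ws) ×-dec (degree H u <? D ×-dec degree H v <? D)
      ×-dec ¬? (v ∈? ball H i u) ×-dec (length L <? suc d * count (mono? (u , v)) L)

    extend : ∀ {a} → a ∈ edges G → Available a →
             Σ (State ws) λ st′ → length (State.L st′) < length L
    extend {a@(u , v)} a∈ ((u∈ , v∈) , (u< , v<) , far , frequent) = record
      { H = addEdge u v H ; L = L′ ; t = suc t
      ; sparse = record
        { H⊆G = λ { (here refl) → uv ; (there (here refl)) → Adj-sym uv ; (there (there p)) → H⊆G p }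
        ; H-sym = addEdge-symmetric H-sym
        ; noShort = addEdge-noShortCycle H-sym (λ walk → far (ball⁺ walk)) noShort }
      ; degree≤D = degree-addEdge {H = H} (Adj⇒≢ uv) u< v< degree≤D
      ; length-H = trans (cong (2 +_) length-H) (sym (*-suc 2 t))
      ; complete = complete′
      ; few = few′ } , shorter
      where
      uv : Adj u v
      uv = edge⇒Adj a∈
      L′ = filter (λ f → ¬? (mono? a f)) L
      split : count (mono? a) L + length L′ ≡ length L
      split = count+filter-¬ (mono? a) L
      shorter : length L′ < length L
      shorter = subst (length L′ <_) split (+-monoˡ-≤ (length L′) (*-cancelˡ-< (suc d) 0 _
        (≤-<-trans (≤-trans (≤-reflexive (*-zeroʳ (suc d))) z≤n) frequent)))
      complete′ : ∀ f → Proper (addEdge u v H) f → ∃ λ g → g ∈ L′ × (∀ {w} → w ∈ ws → g w ≡ f w)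
      complete′ f proper with complete f (proper ∘ there ∘ there)
      ... | g , g∈ , agree = g , ∈-filter⁺ _ g∈ (λ gu≡gv → proper (here refl)
              (trans (sym (agree u∈)) (trans gu≡gv (agree v∈)))) , agree
      -- More than a fraction `1/Δ` of `L` is removed; adding `length L` to both sides avoids
      -- subtraction.
      L′≤ : suc d * length L′ ≤ d * length L
      L′≤ = +-cancelˡ-≤ (length L) _ _ (begin
        length L + suc d * length L′                          ≤⟨ +-monoˡ-≤ _ (<⇒≤ frequent) ⟩
        suc d * count (mono? a) L + suc d * length L′         ≡⟨ sym (*-distribˡ-+ (suc d) (count (mono? a) L) (length L′)) ⟩
        suc d * (count (mono? a) L + length L′)               ≡⟨ cong (suc d *_) split ⟩
        suc d * length L                                      ∎)
        where open ≤-Reasoning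
      few′ : length L′ * suc d ^ suc t ≤ c ^ length ws * d ^ suc t
      few′ = begin
        length L′ * (suc d * suc d ^ t)       ≡⟨ rearrange (length L′) (suc d) (suc d ^ t) ⟩
        suc d * length L′ * suc d ^ t         ≤⟨ *-monoˡ-≤ (suc d ^ t) L′≤ ⟩
        d * length L * suc d ^ t              ≡⟨ *-assoc d (length L) (suc d ^ t) ⟩
        d * (length L * suc d ^ t)            ≤⟨ *-monoʳ-≤ d few ⟩
        d * (c ^ length ws * d ^ t)           ≡⟨ rearrange′ d (c ^ length ws) (d ^ t) ⟩
        c ^ length ws * (d * d ^ t)           ∎
        where
        open ≤-Reasoning
        rearrange : ∀ l d x → l * (d * x) ≡ d * l * x
        rearrange = solve-∀
        rearrange′ : ∀ d k x → d * (k * x) ≡ k * (d * x)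
        rearrange′ = solve-∀

  Stuck : ∀ {ws} → State ws → Set
  Stuck st = 1 ≤ length (State.L st) × (∀ {a} → a ∈ edges G → ¬ Available st a)

  -- By `complete`, a proper colouring of `H` would have a representative in the empty list `L`.
  exhausted : ∀ {ws} (st : State ws) → ¬ 1 ≤ length (State.L st) → Goal
  exhausted st L≱1 = H , sparse , λ f proper → L≱1 (∈-length (proj₁ (proj₂ (complete f proper))))
    where open State st

  -- Each added edge is frequent and so removes some colouring from `L`, whose length therefore
  -- bounds the number of steps.
  run : ∀ {ws} fuel (st : State ws) → length (State.L st) ≤ fuel → Goal ⊎ Σ (State ws) Stuck
  run zero st L≤0 = inj₁ (exhausted st λ 1≤L → contradiction (≤-trans 1≤L L≤0) λ ())
  run (suc fuel) st L≤fuel with 1 ≤? length (State.L st)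
  ... | no L≱1  = inj₁ (exhausted st L≱1)
  ... | yes 1≤L with Any.any? (available? st) (edges G)
  ...   | no none  = inj₂ (st , 1≤L , λ a∈ available → none (lose a∈ available))
  ...   | yes some with find some
  ...     | a , a∈ , available with extend st a∈ available
  ...       | st′ , shorter = run fuel st′ (≤-pred (≤-trans shorter L≤fuel))

  -- Colours are natural numbers below `m` rather than elements of `Fin m`, so that the palettes of
  -- successive rounds can be stacked by addition.
  ColouringOn : List V → ℕ → Set
  ColouringOn ws m = Σ (V → ℕ) λ φ →
    (∀ {v} → v ∈ ws → φ v < m) × (∀ {u v} → u ∈ ws → v ∈ ws → Adj u v → φ u ≢ φ v)

  module AtStuck {ws : List V} (unique : Unique ws) (st : State ws) (stuck : Stuck st) where
    open State st
    open Sparse sparse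

    saturated? : (v : V) → Dec (D ≤ degree H v)
    saturated? v = D ≤? degree H v

    F : List V
    F = filter saturated? ws

    unique-F : Unique F
    unique-F = Unique.filter⁺ saturated? unique

    -- A nonempty `L` forces `1 ≤ c^|ws| (1 - 1/Δ)^t`.
    t≤ : t ≤ suc d * (c * length ws)
    t≤ = steps-bound c d (length ws) t (≤-trans
      (≤-trans (≤-reflexive (sym (*-identityˡ (suc d ^ t)))) (*-monoˡ-≤ (suc d ^ t) (proj₁ stuck))) few)

    -- Saturated vertices account for at least `D = 4Δc` arcs each, out of a total of
    -- `2t ≤ 2Δc|ws|`.
    2F≤ : 2 * length F ≤ length ws
    2F≤ = *-cancelˡ-≤ (2 * (suc d * c)) (begin
      2 * (suc d * c) * (2 * length F)        ≡⟨ rearrange (suc d * c) (length F) ⟩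
      length F * D                            ≤⟨ degree-sum H unique-F (λ w∈ → proj₂ (∈-filter⁻ saturated? {xs = ws} w∈)) ⟩
      length H                                ≡⟨ length-H ⟩
      2 * t                                   ≤⟨ *-monoʳ-≤ 2 t≤ ⟩
      2 * (suc d * (c * length ws))           ≡⟨ rearrange′ (suc d) c (length ws) ⟩
      2 * (suc d * c) * length ws             ∎)
      where
      open ≤-Reasoning
      rearrange : ∀ x f → 2 * x * (2 * f) ≡ f * (4 * x)
      rearrange = solve-∀
      rearrange′ : ∀ d c w → 2 * (d * (c * w)) ≡ 2 * (d * c) * w
      rearrange′ = solve-∀

    rare? : (a : V × V) → Dec (suc d * count (mono? a) L ≤ length L)
    rare? a = suc d * count (mono? a) L ≤? length L

    separating : Σ (V → Fin (c ^ N)) λ ψ → ∀ u v → (u , v) ∈ filter rare? (edges G) → ψ u ≢ ψ v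
    separating = separating-colouring L (suc d) (proj₁ stuck) N (filter rare? (edges G))
      (λ p → proj₂ (∈-filter⁻ rare? {xs = edges G} p))
      (≤-<-trans (≤-trans (≤-reflexive (length-filter≡count rare? (edges G)))
        (≤-trans (m≤m+n _ _) (≤-reflexive (count+filter-¬ rare? (edges G))))) e<)

    ψ : V → Fin (c ^ N)
    ψ = proj₁ separating

    ball-colouring : Σ (V → Fin (suc z)) λ ζ → ∀ u v → u ≢ v → Walk H i u v → ζ u ≢ ζ v
    ball-colouring = greedy-colouring (Walk H i) (walk-reverse H-sym) (ball H i) (length-ball degree≤D i) ball⁺

    ζ : V → Fin (suc z)
    ζ = proj₁ ball-colouring

    -- If `ζ` agrees on the ends, no short walk joins them, so in a stuck state only frequency can
    -- fail; the edge is then rare and `ψ` separates it.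
    unsaturated : ∀ {u v} → (u , v) ∈ edges G → u ∈ ws → v ∈ ws → ¬ D ≤ degree H u → ¬ D ≤ degree H v →
                  ψ u ≡ ψ v → ζ u ≢ ζ v
    unsaturated {u} {v} uv u∈ v∈ u< v< ψ≡ ζ≡ = proj₂ separating u v
      (∈-filter⁺ rare? uv (≮⇒≥ λ frequent → proj₂ stuck uv
        ((u∈ , v∈) , (≰⇒> u< , ≰⇒> v<) ,
         (λ v∈ball → proj₂ ball-colouring u v (Adj⇒≢ (edge⇒Adj uv)) (ball⁻ i v∈ball) ζ≡) , frequent))) ψ≡

    -- Saturated vertices keep their colours below `m` and the others receive colours from `m` on,
    -- so edges between the two classes are proper automatically.
    extend-colouring : ∀ {m} → ColouringOn F m → ColouringOn ws (y + m)
    extend-colouring {m} (φ , φ< , proper) = φ′ , φ′< , proper′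
      where
      code : V → Fin y
      code v = Fin.combine (ψ v) (ζ v)
      φ′ : V → ℕ
      φ′ v with saturated? v
      ... | yes _ = φ v
      ... | no _  = m + Fin.toℕ (code v)
      F∋ : ∀ {v} → v ∈ ws → D ≤ degree H v → v ∈ F
      F∋ = ∈-filter⁺ saturated?
      φ′< : ∀ {v} → v ∈ ws → φ′ v < y + m
      φ′< {v} v∈ with saturated? v
      ... | yes sat = ≤-trans (φ< (F∋ v∈ sat)) (m≤n+m m y)
      ... | no _    = ≤-trans (+-monoʳ-< m (Fin.toℕ<n (code v))) (≤-reflexive (+-comm m y))
      proper′ : ∀ {u v} → u ∈ ws → v ∈ ws → Adj u v → φ′ u ≢ φ′ v
      proper′ {u} {v} u∈ v∈ uv eq with saturated? u | saturated? v
      ... | yes su | yes sv = proper (F∋ u∈ su) (F∋ v∈ sv) uv eq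
      ... | yes su | no _   = <⇒≢ (≤-trans (φ< (F∋ u∈ su)) (m≤m+n m _)) eq
      ... | no _   | yes sv = >⇒≢ (≤-trans (φ< (F∋ v∈ sv)) (m≤m+n m _)) eq
      ... | no su  | no sv with Fin.combine-injective _ _ _ _ (Fin.toℕ-injective (+-cancelˡ-≡ m _ _ eq)) | Adj⇒edge uv
      ...   | ψ≡ , ζ≡ | inj₁ p = unsaturated p u∈ v∈ su sv ψ≡ ζ≡
      ...   | ψ≡ , ζ≡ | inj₂ p = unsaturated p v∈ u∈ sv su (sym ψ≡) (sym ζ≡)

  -- Saturated vertices are at most half of all vertices, so recursing on them ends after j rounds.
  goal-or-colouring : ∀ j ws → Unique ws → length ws < 2 ^ j → Goal ⊎ ColouringOn ws (j * y)
  goal-or-colouring zero    []      unique _ = inj₂ ((λ _ → 0) , (λ ()) , λ ())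
  goal-or-colouring zero    (_ ∷ _) unique (s≤s ())
  goal-or-colouring (suc j) ws unique ws< with run _ (initial ws) ≤-refl
  ... | inj₁ goal = inj₁ goal
  ... | inj₂ (st , stuck) with goal-or-colouring j F unique-F
          (*-cancelˡ-< 2 (length F) (2 ^ j) (≤-<-trans 2F≤ ws<))
        where open AtStuck unique st stuck
  ...   | inj₁ goal      = inj₁ goal
  ...   | inj₂ colouring = inj₂ (AtStuck.extend-colouring unique st stuck colouring)

-- From arcs to graphs

χ-≤ : ∀ G {m} → Colourable G m → χ G ≤ m
χ-≤ G colouring = proj₂ (proj₂ (least (colourable? G) (Graph.order G , identity-colouring G))) _ colouring

χ-colourable : ∀ G → Colourable G (χ G)
χ-colourable G = proj₁ (proj₂ (least (colourable? G) (Graph.order G , identity-colouring G)))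

χ-> : ∀ G {m} → ¬ Colourable G m → m < χ G
χ-> G {m} ¬colourable = ≰⇒> λ χ≤m → let f , proper = χ-colourable G in
  ¬colourable ((λ v → Fin.inject≤ (f v) χ≤m) , λ u v uv eq → proper u v uv (Fin.inject≤-injective χ≤m χ≤m _ _ eq))

girth-≥ : ∀ G {r} → (∀ l → HasCycle G l → r ≤ l) → [ r ] ≤⁺ girth G
girth-≥ G {r} r≤ with cyclic? G
... | yes cycle = [ r≤ _ (proj₁ (proj₂ (least (hasCycle? G) cycle))) ]≤
... | no _      = [ r ] ≤⊤⁺

-- A total passage from ℕ to `Fin`, used both for positions on a cycle and for colours.
clamp : ∀ l → ℕ → Fin (suc l)
clamp l t = Fin.fromℕ< (s≤s (m⊓n≤n t l))

toℕ-clamp : ∀ {l t} → t ≤ l → Fin.toℕ (clamp l t) ≡ t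
toℕ-clamp t≤l = trans (Fin.toℕ-fromℕ< _) (m≤n⇒m⊓n≡m t≤l)

module _ {n : ℕ} (H : Arcs (Fin n)) (H-sym : Symmetricᴬ H) (loopless : ∀ u → (u , u) ∉ H) where

  open DecMembership (≡-dec (Fin._≟_ {n}) (Fin._≟_ {n})) using (_∈?_)

  arcsGraph : Graph
  arcsGraph = record
    { order = n
    ; adj = λ u v → does ((u , v) ∈? H)
    ; symmetric = λ u v → does-⇔ (mk⇔ H-sym H-sym) ((u , v) ∈? H) ((v , u) ∈? H)
    ; loopless = λ u → dec-false ((u , u) ∈? H) (loopless u) }

  arcsGraph-adj⁺ : ∀ {u v} → (u , v) ∈ H → Graph.Adj arcsGraph u v
  arcsGraph-adj⁺ {u} {v} p with (u , v) ∈? H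
  ... | yes _  = _
  ... | no ¬p = contradiction p ¬p

  arcsGraph-adj⁻ : ∀ {u v} → Graph.Adj arcsGraph u v → (u , v) ∈ H
  arcsGraph-adj⁻ {u} {v} uv with (u , v) ∈? H
  ... | yes p = p

  arcsGraph-cycle : ∀ {l v} → IsCycle arcsGraph l v → Cycle H l (v ∘ clamp l)
  arcsGraph-cycle {l} {v} (2≤l , inj , path , close) = record
    { 2≤l = 2≤l
    ; injective = λ s≤l t≤l eq → trans (sym (toℕ-clamp s≤l)) (trans (cong Fin.toℕ (inj eq)) (toℕ-clamp t≤l))
    ; arcs = λ {t} t<l → subst₂ (λ a b → (v a , v b) ∈ H)
        (Fin.toℕ-injective (trans (Fin.toℕ-inject₁ _) (trans (Fin.toℕ-fromℕ< t<l) (sym (toℕ-clamp (<⇒≤ t<l))))))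
        (Fin.toℕ-injective (trans (cong suc (Fin.toℕ-fromℕ< t<l)) (sym (toℕ-clamp t<l))))
        (arcsGraph-adj⁻ (path (Fin.fromℕ< t<l)))
    ; closing = subst (λ a → (v a , v Fin.zero) ∈ H)
        (Fin.toℕ-injective (trans (Fin.toℕ-fromℕ l) (sym (toℕ-clamp ≤-refl))))
        (arcsGraph-adj⁻ close) }

-- Isolated vertices leave the order of `G` uncontrolled by `e G`, so the rounds start from the at
-- most `2 * e G` endpoints of edges.
endpoints : ∀ {V : Set} → List (V × V) → List V
endpoints []            = []
endpoints ((u , v) ∷ E) = u ∷ v ∷ endpoints E

length-endpoints : ∀ {V : Set} (E : List (V × V)) → length (endpoints E) ≡ 2 * length E
length-endpoints []      = refl
length-endpoints (_ ∷ E) = trans (cong (2 +_) (length-endpoints E)) (sym (*-suc 2 (length E)))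

∈-endpoints : ∀ {V : Set} {E : List (V × V)} {u v} → (u , v) ∈ E → u ∈ endpoints E × v ∈ endpoints E
∈-endpoints (here refl) = here refl , there (here refl)
∈-endpoints (there p)   = let u∈ , v∈ = ∈-endpoints p in there (there u∈) , there (there v∈)

module _ (G : Graph) (i c′ d N J : ℕ) (e< : e G < suc d ^ N) (2e< : 2 * e G < 2 ^ J) where

  open Graph G using (Adj) renaming (order to n)
  open Process G i c′ d N e<

  private
    V = Fin n
    ws : List V
    ws = deduplicate Fin._≟_ (endpoints (edges G))

  high-girth-subgraph : suc (J * y) < χ G →
    Σ Graph λ K → K ⊑ G × [ 2 + i ] ≤⁺ girth K × 2 + c′ ≤ χ K
  high-girth-subgraph χ> with goal-or-colouring J ws (deduplicate-! Fin._≟_ (endpoints (edges G)))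
    (≤-<-trans (≤-trans (length-deduplicate Fin._≟_ (endpoints (edges G))) (≤-reflexive (length-endpoints (edges G)))) 2e<)
  ... | inj₁ (H , sparse , uncolourable) = K
      , ((λ v → v) , (λ eq → eq) , λ u v uv → H⊆G (adj⁻ uv))
      , girth-≥ K long
      , χ-> K λ (f , proper) → uncolourable f λ {u} {v} p → proper u v (adj⁺ p)
    where
    open Sparse sparse
    noLoop : ∀ u → (u , u) ∉ H
    noLoop u p = Adj⇒≢ (H⊆G p) refl
    K = arcsGraph H H-sym noLoop
    adj⁺ = arcsGraph-adj⁺ H H-sym noLoop
    adj⁻ : ∀ {u v} → Graph.Adj K u v → (u , v) ∈ H
    adj⁻ = arcsGraph-adj⁻ H H-sym noLoop
    long : ∀ l → HasCycle K l → 2 + i ≤ l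
    long (suc l) (v , cycle) = s≤s (≰⇒> λ l≤i → noShort l≤i (arcsGraph-cycle H H-sym noLoop {v = v} cycle))
  ... | inj₂ (φ , φ< , proper) = contradiction (χ-≤ G colouring) (<⇒≱ χ>)
    where
    colouring : Colourable G (suc (J * y))
    -- Off `ws` the values of `φ` are unbounded, hence `clamp`, whose target has one colour more
    -- than `J * y`; vertices off `ws` are isolated.
    colouring = (λ v → clamp (J * y) (φ v)) , proper′
      where
      in-ws : ∀ {u v} → Adj u v → u ∈ ws × v ∈ ws
      in-ws uv with Adj⇒edge uv
      ... | inj₁ p = let u∈ , v∈ = ∈-endpoints p in ∈-deduplicate⁺ Fin._≟_ u∈ , ∈-deduplicate⁺ Fin._≟_ v∈
      ... | inj₂ p = let v∈ , u∈ = ∈-endpoints p in ∈-deduplicate⁺ Fin._≟_ u∈ , ∈-deduplicate⁺ Fin._≟_ v∈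
      proper′ : IsColouring G (λ v → clamp (J * y) (φ v))
      proper′ u v uv eq = let u∈ , v∈ = in-ws uv in proper u∈ v∈ uv
        (trans (sym (toℕ-clamp (<⇒≤ (φ< u∈)))) (trans (cong Fin.toℕ eq) (toℕ-clamp (<⇒≤ (φ< v∈)))))

-- Choice of the numerical parameters.

-- The search descends from the exponent `m`, where `m < 2 ^ m ≤ b ^ m`.
floor-log : ∀ b m → 2 ≤ b → 1 ≤ m → ∃ λ N → b ^ N ≤ m × m < b ^ suc N
floor-log b m 2≤b 1≤m = search m (≤-trans (suc≤2^ m) (^-monoˡ-≤ m 2≤b))
  where
  search : ∀ K → m < b ^ K → ∃ λ N → b ^ N ≤ m × m < b ^ suc N
  search zero    m<1 = contradiction 1≤m (<⇒≱ m<1)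
  search (suc K) m<  with b ^ K ≤? m
  ... | yes ≤m = K , ≤m , m<
  ... | no ≰m  = search K (≰⇒> ≰m)

2*n≤2^n : ∀ n → 1 ≤ n → 2 * n ≤ 2 ^ n
2*n≤2^n (suc n) _ = *-monoʳ-≤ 2 (suc≤2^ n)

-- With `n = p + q` and `p ≤ q`, one has `n ≤ 2q ≤ 2^q`.
2^p*n≤2^n : ∀ p n → 1 ≤ p → 2 * p ≤ n → 2 ^ p * n ≤ 2 ^ n
2^p*n≤2^n p n 1≤p 2p≤n = begin
  2 ^ p * n             ≤⟨ *-monoʳ-≤ (2 ^ p) n≤2q ⟩
  2 ^ p * (2 * q)       ≤⟨ *-monoʳ-≤ (2 ^ p) (2*n≤2^n q (≤-trans 1≤p p≤q)) ⟩
  2 ^ p * 2 ^ q         ≡⟨ sym (^-distribˡ-+-* 2 p q) ⟩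
  2 ^ (p + q)           ≡⟨ cong (2 ^_) p+q≡n ⟩
  2 ^ n                 ∎
  where
  open ≤-Reasoning
  q = n ∸ p
  p+q≡n : p + q ≡ n
  p+q≡n = m+[n∸m]≡n (≤-trans (m≤m+n p (p + 0)) 2p≤n)
  p≤q : p ≤ q
  p≤q = +-cancelˡ-≤ p p q (≤-trans (≤-reflexive (cong (p +_) (sym (+-identityʳ p)))) (≤-trans 2p≤n (≤-reflexive (sym p+q≡n))))
  n≤2q : n ≤ 2 * q
  n≤2q = ≤-trans (≤-reflexive (sym p+q≡n)) (≤-trans (+-monoˡ-≤ q p≤q) (≤-reflexive (cong (q +_) (sym (+-identityʳ q)))))

-- The logarithm to base 4^(c′ + 1) of the threshold for girth 2 + i, when P + log C ≤ A.
logThreshold : ℕ → ℕ → ℕ → ℕ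
logThreshold c′ A i = 8 * (22 * suc c′ * A) * (2 + i)

module _ (c′ A i : ℕ) (1≤A : 1 ≤ A) where

  private
    c = suc c′
    -- `Δ` will be `2 ^ h`; the constant 22 is the one for which `edge-bound-<` yields
    -- `e G < Δ ^ N`.
    h = 22 * c * A

  private
    22c≤h : 22 * c ≤ h
    22c≤h = ≤-trans (≤-reflexive (sym (*-identityʳ (22 * c)))) (*-monoʳ-≤ (22 * c) 1≤A)

    degree-bound : suc (4 * (2 ^ h * c)) ≤ 2 ^ (2 * h)
    degree-bound = begin
      1 + 4 * (2 ^ h * c)             ≤⟨ +-monoˡ-≤ (4 * (2 ^ h * c)) (≤-trans (m^n>0 2 h) (m≤n*m (2 ^ h) 4)) ⟩
      4 * 2 ^ h + 4 * (2 ^ h * c)     ≡⟨ rearrange (2 ^ h) c ⟩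
      2 ^ 2 * 2 ^ h * suc c           ≤⟨ *-monoʳ-≤ (2 ^ 2 * 2 ^ h) (suc≤2^ c) ⟩
      2 ^ 2 * 2 ^ h * 2 ^ c           ≡⟨ cong (_* 2 ^ c) (sym (^-distribˡ-+-* 2 2 h)) ⟩
      2 ^ (2 + h) * 2 ^ c             ≡⟨ sym (^-distribˡ-+-* 2 (2 + h) c) ⟩
      2 ^ (2 + h + c)                 ≤⟨ ^-monoʳ-≤ 2 2+h+c≤2h ⟩
      2 ^ (2 * h)                     ∎
      where
      open ≤-Reasoning
      rearrange : ∀ x c → 4 * x + 4 * (x * c) ≡ 4 * x * (1 + c)
      rearrange = solve-∀
      split : ∀ c′ → 22 * (1 + c′) ≡ 3 + c′ + (19 + 21 * c′)
      split = solve-∀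
      2+h+c≤2h : 2 + h + c ≤ 2 * h
      2+h+c≤2h = begin
        2 + h + c     ≡⟨ rearrange′ h c′ ⟩
        h + (3 + c′)  ≤⟨ +-monoʳ-≤ h (≤-trans (≤-trans (m≤m+n (3 + c′) _) (≤-reflexive (sym (split c′)))) 22c≤h) ⟩
        h + h         ≡⟨ cong (h +_) (sym (+-identityʳ h)) ⟩
        2 * h         ∎
        where
        rearrange′ : ∀ h c′ → 2 + h + (1 + c′) ≡ h + (3 + c′)
        rearrange′ = solve-∀

    -- The left side is `suc (J * y)` for `J = hN + 1` rounds, enough because `2 * e G < 2^(hN+1)`.
    -- The factor `c^N` is at most `2^(cN)`; the others together are at most `2^p N`, which is at
    -- most `2^N` because `logThreshold` is `2p`. Hence the base `4^c`.
    palette-bound : ∀ N → logThreshold c′ A i ≤ N →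
      suc (suc (h * N) * (c ^ N * suc (suc (4 * (2 ^ h * c)) ^ i))) < 4 ^ (c * N)
    palette-bound N L≤N = ≤-trans (2+x≤4x x 1≤x) (begin
      4 * (suc (h * N) * (c ^ N * suc z))
        ≤⟨ *-monoʳ-≤ 4 (*-mono-≤ J≤ (*-mono-≤ (^-≤-2^ c N) z≤)) ⟩
      4 * (2 ^ h * N * (2 ^ (c * N) * (2 * 2 ^ (2 * h * i))))
        ≡⟨ rearrange (2 ^ h) N (2 ^ (c * N)) (2 ^ (2 * h * i)) ⟩
      2 ^ 3 * 2 ^ h * 2 ^ (2 * h * i) * N * 2 ^ (c * N)
        ≡⟨ cong (λ x → x * N * 2 ^ (c * N)) (trans (cong (_* 2 ^ (2 * h * i)) (sym (^-distribˡ-+-* 2 3 h))) (sym (^-distribˡ-+-* 2 (3 + h) (2 * h * i)))) ⟩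
      2 ^ (3 + h + 2 * h * i) * N * 2 ^ (c * N)
        ≤⟨ *-monoˡ-≤ (2 ^ (c * N)) (*-monoˡ-≤ N (^-monoʳ-≤ 2 exponent≤)) ⟩
      2 ^ p * N * 2 ^ (c * N)
        ≤⟨ *-monoˡ-≤ (2 ^ (c * N)) (2^p*n≤2^n p N 1≤p 2p≤N) ⟩
      2 ^ N * 2 ^ (c * N)
        ≤⟨ *-monoˡ-≤ (2 ^ (c * N)) (^-monoʳ-≤ 2 (m≤n*m N c)) ⟩
      2 ^ (c * N) * 2 ^ (c * N)
        ≡⟨ sym (^-distribʳ-* (c * N) 2 2) ⟩
      4 ^ (c * N) ∎)
      where
      open ≤-Reasoning
      z = suc (4 * (2 ^ h * c)) ^ i
      x = suc (h * N) * (c ^ N * suc z)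
      p = 4 * h * (2 + i)
      1≤h : 1 ≤ h
      1≤h = ≤-trans (s≤s z≤n) 22c≤h
      1≤p : 1 ≤ p
      1≤p = *-mono-≤ (*-mono-≤ {1} {4} (s≤s z≤n) 1≤h) (s≤s z≤n)
      2p≤N : 2 * p ≤ N
      2p≤N = ≤-trans (≤-reflexive (identity h i)) L≤N
        where
        identity : ∀ h i → 2 * (4 * h * (2 + i)) ≡ 8 * h * (2 + i)
        identity = solve-∀
      1≤N : 1 ≤ N
      1≤N = ≤-trans (≤-trans 1≤p (m≤m+n p (p + 0))) 2p≤N
      1≤x : 1 ≤ x
      1≤x = *-mono-≤ {1} {suc (h * N)} (s≤s z≤n) (*-mono-≤ {1} {c ^ N} (m^n>0 c N) (s≤s z≤n))
      2+x≤4x : ∀ x → 1 ≤ x → suc (suc x) ≤ 4 * x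
      2+x≤4x (suc x) _ = ≤-trans (m≤m+n (3 + x) (1 + 3 * x)) (≤-reflexive (identity x))
        where
        identity : ∀ x → 3 + x + (1 + 3 * x) ≡ 4 * (1 + x)
        identity = solve-∀
      J≤ : suc (h * N) ≤ 2 ^ h * N
      J≤ = ≤-trans (+-monoˡ-≤ (h * N) 1≤N) (*-monoˡ-≤ N (suc≤2^ h))
      z≤ : suc z ≤ 2 * 2 ^ (2 * h * i)
      z≤ = begin
        suc z                                   ≤⟨ +-mono-≤ (m^n>0 2 (2 * h * i)) (≤-trans (^-monoˡ-≤ i degree-bound) (≤-reflexive (^-*-assoc 2 (2 * h) i))) ⟩
        2 ^ (2 * h * i) + 2 ^ (2 * h * i)       ≡⟨ cong (2 ^ (2 * h * i) +_) (sym (+-identityʳ _)) ⟩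
        2 * 2 ^ (2 * h * i)                     ∎
      exponent≤ : 3 + h + 2 * h * i ≤ p
      exponent≤ = begin
        3 + h + 2 * h * i                       ≤⟨ +-monoˡ-≤ (2 * h * i) (+-monoˡ-≤ h (*-monoʳ-≤ 3 1≤h)) ⟩
        3 * h + h + 2 * h * i                   ≤⟨ m≤m+n _ (4 * h + 2 * h * i) ⟩
        3 * h + h + 2 * h * i + (4 * h + 2 * h * i)   ≡⟨ identity h i ⟩
        p                                       ∎
        where
        identity : ∀ h i → 3 * h + h + 2 * h * i + (4 * h + 2 * h * i) ≡ 4 * h * (2 + i)
        identity = solve-∀
      rearrange : ∀ a n b z → 4 * (a * n * (b * (2 * z))) ≡ 8 * a * z * n * b
      rearrange = solve-∀

  few-edges⇒high-girth-subgraph : (G : Graph) (N : ℕ) → logThreshold c′ A i ≤ N → 4 ^ (c * N) ≤ χ G → e G < 2 ^ (h * N) →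
    Σ Graph λ K → K ⊑ G × [ 2 + i ] ≤⁺ girth K × 2 + c′ ≤ χ K
  few-edges⇒high-girth-subgraph G N L≤N χ≥ e< =
    high-girth-subgraph G i c′ d N (suc (h * N)) e<′ (*-monoʳ-< 2 e<)
      (subst (λ m → suc (suc (h * N) * (c ^ N * suc (suc (4 * (m * c)) ^ i))) < χ G) (sym 1+d≡2^h)
        (<-≤-trans (palette-bound N L≤N) χ≥))
    where
    d = pred (2 ^ h)
    1+d≡2^h : suc d ≡ 2 ^ h
    1+d≡2^h = suc-pred (2 ^ h) {{>-nonZero (m^n>0 2 h)}}
    e<′ : e G < suc d ^ N
    e<′ = subst (e G <_) (trans (sym (^-*-assoc 2 h N)) (cong (_^ N) (sym 1+d≡2^h))) e<

-- Bounds on the exponential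

fromℕ-cancel-≤ : ∀ {m n} → fromℕ m ≤ℚ fromℕ n → m ≤ n
fromℕ-cancel-≤ {m} {n} h = ≮⇒≥ λ n<m → ℚ.<-irrefl refl (begin-strict
  fromℕ n            ≡⟨ sym (ℚ.+-identityˡ (fromℕ n)) ⟩
  0ℚ +ℚ fromℕ n      <⟨ ℚ.+-monoˡ-< (fromℕ n) 0<1 ⟩
  1ℚ +ℚ fromℕ n      ≡⟨ sym (fromℕ-suc n) ⟩
  fromℕ (suc n)      ≤⟨ fromℕ-mono n<m ⟩
  fromℕ m            ≤⟨ h ⟩
  fromℕ n            ∎)
  where open ℚ.≤-Reasoning

partialExp-≤ : ∀ n {x y} → 0ℚ ≤ℚ x → x ≤ℚ y → partialExp n x ≤ℚ partialExp n y
partialExp-≤ zero    0≤x x≤y = ℚ.≤-refl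
partialExp-≤ (suc n) 0≤x x≤y = +-≤ (partialExp-≤ n 0≤x x≤y) (term-mono n 0≤x x≤y)

0≤partialExp : ∀ n {x} → 0ℚ ≤ℚ x → 0ℚ ≤ℚ partialExp n x
0≤partialExp n 0≤x = partialExp-mono {0} {n} 0≤x z≤n

-- The Lipschitz constant on [0 , x + ½] is the value at x + ½, so a step of ½ at most doubles the value.
partialExp-half-step : ∀ n {x} → 0ℚ ≤ℚ x → partialExp n (x +ℚ ½) *ℚ ½ ≤ℚ partialExp n x
partialExp-half-step n {x} 0≤x = begin
  E′ *ℚ ½                    ≡⟨ solve 1 (λ a → a :* con ½ := a :- a :* con ½) refl E′ ⟩
  E′ -ℚ E′ *ℚ ½              ≤⟨ ℚ.+-monoˡ-≤ (ℚ.- (E′ *ℚ ½)) (∣-∣-elim {E′} {E} difference) ⟩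
  E +ℚ E′ *ℚ ½ -ℚ E′ *ℚ ½    ≡⟨ solve 2 (λ a b → a :+ b :- b := a) refl E (E′ *ℚ ½) ⟩
  E                          ∎
  where
  open ℚ.≤-Reasoning
  E  = partialExp n x
  E′ = partialExp n (x +ℚ ½)
  0≤½ : 0ℚ ≤ℚ ½
  0≤½ = ℚ.nonNegative⁻¹ ½
  difference : ∣ E′ -ℚ E ∣ ≤ℚ E′ *ℚ ½
  difference = begin
    ∣ E′ -ℚ E ∣                  ≤⟨ partialExp-lipschitz n (ℚ.≤-reflexive (ℚ.0≤p⇒∣p∣≡p (0≤+ 0≤x 0≤½)))
                                      (ℚ.≤-trans (ℚ.≤-reflexive (ℚ.0≤p⇒∣p∣≡p 0≤x)) (p≤p+q 0≤½)) ⟩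
    E′ *ℚ ∣ (x +ℚ ½) -ℚ x ∣      ≡⟨ cong (λ z → E′ *ℚ ∣ z ∣) (solve 1 (λ x → x :+ con ½ :- x := con ½) refl x) ⟩
    E′ *ℚ ½                      ∎

-- A unit step consists of two half steps, each at most doubling the value, uniformly in the number
-- `n` of terms.
partialExp-≤-4^ : ∀ n K → partialExp n (fromℕ K) ≤ℚ fromℕ (4 ^ K)
partialExp-≤-4^ zero    zero = 0≤1
partialExp-≤-4^ (suc n) zero = ℚ.≤-reflexive (partialExp-0 n)
partialExp-≤-4^ n (suc K) = begin
  partialExp n (fromℕ (suc K))
    ≡⟨ cong (partialExp n) (trans (fromℕ-suc K) (solve 1 (λ k → con 1ℚ :+ k := k :+ con ½ :+ con ½) refl (fromℕ K))) ⟩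
  partialExp n (fromℕ K +ℚ ½ +ℚ ½)
    ≡⟨ solve 1 (λ a → a := con (fromℕ 4) :* (a :* con ½ :* con ½)) refl (partialExp n (fromℕ K +ℚ ½ +ℚ ½)) ⟩
  fromℕ 4 *ℚ (partialExp n (fromℕ K +ℚ ½ +ℚ ½) *ℚ ½ *ℚ ½)
    ≤⟨ *-≤ˡ (fromℕ 4) (0≤fromℕ 4) (*-≤ʳ ½ 0≤½ (partialExp-half-step n (0≤+ (0≤fromℕ K) 0≤½))) ⟩
  fromℕ 4 *ℚ (partialExp n (fromℕ K +ℚ ½) *ℚ ½)
    ≤⟨ *-≤ˡ (fromℕ 4) (0≤fromℕ 4) (partialExp-half-step n (0≤fromℕ K)) ⟩
  fromℕ 4 *ℚ partialExp n (fromℕ K)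
    ≤⟨ *-≤ˡ (fromℕ 4) (0≤fromℕ 4) (partialExp-≤-4^ n K) ⟩
  fromℕ 4 *ℚ fromℕ (4 ^ K)
    ≡⟨ sym (fromℕ-* 4 (4 ^ K)) ⟩
  fromℕ (4 ^ suc K) ∎
  where
  open ℚ.≤-Reasoning
  0≤½ : 0ℚ ≤ℚ ½
  0≤½ = ℚ.nonNegative⁻¹ ½

-- At `2j` the ratio `2j / (i+1)` of consecutive terms is at least 2 as long as `i < j`.
2^-≤-term : ∀ {i j} → i ≤ j → fromℕ (2 ^ i) ≤ℚ term i (fromℕ (2 * j))
2^-≤-term {zero}      i≤j = ℚ.≤-refl
2^-≤-term {suc i} {j} i<j = begin
  fromℕ (2 * 2 ^ i)                                   ≡⟨ trans (cong fromℕ (*-comm 2 (2 ^ i))) (fromℕ-* (2 ^ i) 2) ⟩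
  fromℕ (2 ^ i) *ℚ fromℕ 2                            ≤⟨ *-≤ (0≤fromℕ 2) (0≤term i (0≤fromℕ (2 * j))) (2^-≤-term (<⇒≤ i<j)) ratio ⟩
  term i (fromℕ (2 * j)) *ℚ (fromℕ (2 * j) *ℚ 1/suc i)  ≡⟨ sym (ℚ.*-assoc (term i (fromℕ (2 * j))) (fromℕ (2 * j)) (1/suc i)) ⟩
  term (suc i) (fromℕ (2 * j))                        ∎
  where
  open ℚ.≤-Reasoning
  ratio : fromℕ 2 ≤ℚ fromℕ (2 * j) *ℚ 1/suc i
  ratio = begin
    fromℕ 2                               ≡⟨ sym (ℚ.*-identityʳ (fromℕ 2)) ⟩
    fromℕ 2 *ℚ 1ℚ                         ≡⟨ cong (fromℕ 2 *ℚ_) (sym (1/suc-inverse i)) ⟩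
    fromℕ 2 *ℚ (fromℕ (suc i) *ℚ 1/suc i) ≡⟨ sym (ℚ.*-assoc (fromℕ 2) (fromℕ (suc i)) (1/suc i)) ⟩
    fromℕ 2 *ℚ fromℕ (suc i) *ℚ 1/suc i   ≡⟨ cong (_*ℚ 1/suc i) (sym (fromℕ-* 2 (suc i))) ⟩
    fromℕ (2 * suc i) *ℚ 1/suc i          ≤⟨ *-≤ʳ (1/suc i) (0≤1/suc i) (fromℕ-mono (*-monoʳ-≤ 2 i<j)) ⟩
    fromℕ (2 * j) *ℚ 1/suc i              ∎

-- The term of index `j` alone suffices, and `j < n` ensures that it is present. This serves both to
-- bound logarithms from above and to bound the threshold by an exponential.
2^-≤-partialExp : ∀ {n j x} → j < n → fromℕ (2 * j) ≤ℚ x → fromℕ (2 ^ j) ≤ℚ partialExp n x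
2^-≤-partialExp {n} {j} {x} j<n 2j≤x = begin
  fromℕ (2 ^ j)                    ≤⟨ 2^-≤-term {j} {j} ≤-refl ⟩
  term j (fromℕ (2 * j))           ≤⟨ q≤p+q (0≤partialExp j (0≤fromℕ (2 * j))) ⟩
  partialExp (suc j) (fromℕ (2 * j)) ≤⟨ partialExp-mono (0≤fromℕ (2 * j)) j<n ⟩
  partialExp n (fromℕ (2 * j))     ≤⟨ partialExp-≤ n (0≤fromℕ (2 * j)) 2j≤x ⟩
  partialExp n x                   ∎
  where open ℚ.≤-Reasoning

partialExp-<-2^ : ∀ {m q n l} → m < 2 ^ q → q < n → partialExp n l ≤ℚ fromℕ m → l ≤ℚ fromℕ (2 * q)
partialExp-<-2^ {m} {q} {n} {l} m< q<n E≤m with ℚ.≤-total l (fromℕ (2 * q))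
... | inj₁ l≤2q = l≤2q
... | inj₂ 2q≤l = contradiction m< (≤⇒≯ (fromℕ-cancel-≤ {2 ^ q} {m} (ℚ.≤-trans (2^-≤-partialExp {n} {q} {l} q<n 2q≤l) E≤m)))

log⁺-upper : ∀ {m q n} → 1 ≤ m → m < 2 ^ q → 2 ≤ n → q < n → seq (log⁺ (fromℕℝ m)) n ≤ℚ fromℕ (2 * q)
log⁺-upper {m} {q} {n} 1≤m m< 2≤n q<n = partialExp-<-2^ {m} {q} {n} m< q<n
  (ℚ.≤-trans (gridLog-lower 2≤n (ℚ.p≤q⊔p (fromℕ m) 1ℚ)) (ℚ.⊔-lub ℚ.≤-refl (fromℕ-mono 1≤m)))

0≤log⁺ : ∀ x n → 0ℚ ≤ℚ seq (log⁺ x) n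
0≤log⁺ x n = 0≤gridLog n (seq x n ℚ.⊔ 1ℚ)

-- Real hypotheses evaluated at late indices.

Eventually : (ℕ → Set) → Set
Eventually Q = ∃ λ N → ∀ n → N ≤ n → Q n

infixr 4 _∩_
_∩_ : ∀ {Q R} → Eventually Q → Eventually R → Eventually λ n → Q n × R n
(M , q) ∩ (N , r) = M ⊔ N , λ n h → q n (m⊔n≤o⇒m≤o M N h) , r n (m⊔n≤o⇒n≤o M N h)

eventually-> : ∀ m → Eventually (m <_)
eventually-> m = suc m , λ _ h → h

-- From `N` on the sequence stays within 1 of `q`. So the least natural `A ≥ q + 1` bounds it, and
-- `A ≤ q + 2 ≤ x + 3 ≤ 4x` because `1 ≤ x`.
nat-upper : ∀ x → Eventually (λ n → 1ℚ ≤ℚ seq x n) →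
  ∃ λ A → Eventually λ n → seq x n ≤ℚ fromℕ A × fromℕ A ≤ℚ fromℕ 4 *ℚ seq x n
nat-upper x (N₁ , 1≤x) with cauchy x 1ℚ 0<1
... | N₂ , near = A , N , λ n N≤n →
    ℚ.≤-trans (∣-∣-elim {seq x n} {q} (near n N (m⊔n≤o⇒n≤o N₁ N₂ N≤n) (m≤n⊔m N₁ N₂))) q+1≤A
  , (begin
      fromℕ A                       ≤⟨ A≤q+2 ⟩
      q +ℚ fromℕ 2                  ≤⟨ ℚ.+-monoˡ-≤ (fromℕ 2) (∣-∣-elim {q} {seq x n} (near N n (m≤n⊔m N₁ N₂) (m⊔n≤o⇒n≤o N₁ N₂ N≤n))) ⟩
      seq x n +ℚ 1ℚ +ℚ fromℕ 2      ≡⟨ solve 1 (λ a → a :+ con 1ℚ :+ con (fromℕ 2) := a :+ con (fromℕ 3) :* con 1ℚ) refl (seq x n) ⟩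
      seq x n +ℚ fromℕ 3 *ℚ 1ℚ      ≤⟨ ℚ.+-monoʳ-≤ (seq x n) (*-≤ˡ (fromℕ 3) (0≤fromℕ 3) (1≤x n (m⊔n≤o⇒m≤o N₁ N₂ N≤n))) ⟩
      seq x n +ℚ fromℕ 3 *ℚ seq x n ≡⟨ solve 1 (λ a → a :+ con (fromℕ 3) :* a := con (fromℕ 4) :* a) refl (seq x n) ⟩
      fromℕ 4 *ℚ seq x n            ∎)
  where
  open ℚ.≤-Reasoning
  N = N₁ ⊔ N₂
  q = seq x N
  above? : ∀ j → Dec (q +ℚ 1ℚ ≤ℚ fromℕ j)
  above? j = q +ℚ 1ℚ ℚ.≤? fromℕ j
  ceiling = least above? (ℤ.∣ ↥ (q +ℚ 1ℚ) ∣ , ≤-archimedean (q +ℚ 1ℚ))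
  A = proj₁ ceiling
  q+1≤A : q +ℚ 1ℚ ≤ℚ fromℕ A
  q+1≤A = proj₁ (proj₂ ceiling)
  below : ∀ A → (∀ j → q +ℚ 1ℚ ≤ℚ fromℕ j → A ≤ j) → fromℕ A ≤ℚ q +ℚ fromℕ 2
  below zero    low = 0≤+ (ℚ.≤-trans 0≤1 (1≤x N (m≤m⊔n N₁ N₂))) (0≤fromℕ 2)
  below (suc A) low = begin
    fromℕ (suc A)         ≡⟨ fromℕ-suc A ⟩
    1ℚ +ℚ fromℕ A         ≤⟨ ℚ.+-monoʳ-≤ 1ℚ (ℚ.<⇒≤ (ℚ.≰⇒> λ h → 1+n≰n (low A h))) ⟩
    1ℚ +ℚ (q +ℚ 1ℚ)       ≡⟨ solve 1 (λ q → con 1ℚ :+ (q :+ con 1ℚ) := q :+ con (fromℕ 2)) refl q ⟩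
    q +ℚ fromℕ 2          ∎
  A≤q+2 : fromℕ A ≤ℚ q +ℚ fromℕ 2
  A≤q+2 = below A (proj₂ (proj₂ ceiling))

-- The real inequality gives only `m + 1 - ε` as a lower bound at late indices; a slack `ε ≤ m`
-- still leaves 1.
1≤eventually : ∀ {m} x → fromℕℝ (suc m) ≤ℝ x → (ε : ℚ) → 0ℚ ℚ.< ε → ε ≤ℚ fromℕ m → Eventually λ n → 1ℚ ≤ℚ seq x n
1≤eventually {m} x m<x ε 0<ε ε≤m = proj₁ (m<x ε 0<ε) , λ n n≥ → begin
    1ℚ                                ≡⟨ solve 1 (λ a → con 1ℚ := con 1ℚ :+ a :- a) refl ε ⟩
    1ℚ +ℚ ε -ℚ ε                      ≤⟨ ℚ.+-monoˡ-≤ (ℚ.- ε) (ℚ.+-monoʳ-≤ 1ℚ ε≤m) ⟩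
    1ℚ +ℚ fromℕ m -ℚ ε                ≡⟨ cong (_-ℚ ε) (sym (fromℕ-suc m)) ⟩
    fromℕ (suc m) -ℚ ε                ≤⟨ ℚ.+-monoˡ-≤ (ℚ.- ε) (proj₂ (m<x ε 0<ε) n n≥) ⟩
    seq x n +ℚ ε -ℚ ε                 ≡⟨ solve 2 (λ a b → a :+ b :- b := a) refl (seq x n) ε ⟩
    seq x n                           ∎
  where open ℚ.≤-Reasoning

private
  factor-bound : ∀ {n c l} A → c ≤ℚ partialExp n l +ℚ 1ℚ → 0ℚ ≤ℚ l → l ≤ℚ fromℕ A → c ≤ℚ fromℕ (suc (4 ^ A))
  factor-bound {n} {c} {l} A c≤ 0≤l l≤A = begin
    c                              ≤⟨ c≤ ⟩
    partialExp n l +ℚ 1ℚ           ≤⟨ ℚ.+-monoˡ-≤ 1ℚ (ℚ.≤-trans (partialExp-≤ n 0≤l l≤A) (partialExp-≤-4^ n A)) ⟩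
    fromℕ (4 ^ A) +ℚ 1ℚ            ≡⟨ trans (ℚ.+-comm (fromℕ (4 ^ A)) 1ℚ) (sym (fromℕ-suc (4 ^ A))) ⟩
    fromℕ (suc (4 ^ A))            ∎
    where open ℚ.≤-Reasoning

  power-bound : ∀ {n p l} A q → 0ℚ ≤ℚ p → p ≤ℚ fromℕ A → 0ℚ ≤ℚ l → l ≤ℚ fromℕ q →
                partialExp n (p *ℚ l) ≤ℚ fromℕ (4 ^ (A * q))
  power-bound {n} {p} {l} A q 0≤p p≤A 0≤l l≤q = begin
    partialExp n (p *ℚ l)                ≤⟨ partialExp-≤ n (0≤* 0≤p 0≤l) (*-≤ {p} {fromℕ A} {l} {fromℕ q} 0≤l (0≤fromℕ A) p≤A l≤q) ⟩
    partialExp n (fromℕ A *ℚ fromℕ q)    ≡⟨ cong (partialExp n) (sym (fromℕ-* A q)) ⟩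
    partialExp n (fromℕ (A * q))         ≤⟨ partialExp-≤-4^ n (A * q) ⟩
    fromℕ (4 ^ (A * q))                  ∎
    where open ℚ.≤-Reasoning

  product-bound : ∀ {k c w} a b → fromℕ k ≤ℚ c *ℚ w +ℚ 1ℚ → 0ℚ ≤ℚ w → c ≤ℚ fromℕ a → w ≤ℚ fromℕ b → k ≤ suc (a * b)
  product-bound {k} {c} {w} a b k≤ 0≤w c≤a w≤b = fromℕ-cancel-≤ {k} {suc (a * b)} (begin
    fromℕ k                        ≤⟨ k≤ ⟩
    c *ℚ w +ℚ 1ℚ                   ≤⟨ ℚ.+-monoˡ-≤ 1ℚ (*-≤ {c} {fromℕ a} {w} {fromℕ b} 0≤w (0≤fromℕ a) c≤a w≤b) ⟩
    fromℕ a *ℚ fromℕ b +ℚ 1ℚ       ≡⟨ ℚ.+-comm (fromℕ a *ℚ fromℕ b) 1ℚ ⟩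
    1ℚ +ℚ fromℕ a *ℚ fromℕ b       ≡⟨ cong (1ℚ +ℚ_) (sym (fromℕ-* a b)) ⟩
    1ℚ +ℚ fromℕ (a * b)            ≡⟨ sym (fromℕ-suc (a * b)) ⟩
    fromℕ (suc (a * b))            ∎)
    where open ℚ.≤-Reasoning

-- The conclusion compares naturals, so a single late index is enough. There
-- `C ≤ exp (log C) + 1 ≤ 4^A + 1`, and `m^P = exp (P log m) ≤ 4^(2Aq)` because `log m ≤ 2q`. Both
-- successors in the bound are the slack of `≤ℝ`, taken to be 1.
edge-bound : ∀ (P C : ℝ) (A : ℕ) → fromℕℝ 1 ≤ℝ C →
  Eventually (λ n → 0ℚ ≤ℚ seq P n × seq P n ≤ℚ fromℕ A) →
  Eventually (λ n → seq (log⁺ C) n ≤ℚ fromℕ A) →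
  ∀ {k m q} → 1 ≤ m → m < 2 ^ q → fromℕℝ k ≤ℝ C *ℝ m ^ℝ P →
  k ≤ suc (suc (4 ^ A) * 4 ^ (A * (2 * q)))
edge-bound P C A 1≤C P≤A logC≤A {k} {suc m} {q} 1≤m m< k≤ = at facts
  where
  l : ℕ → ℚ
  l = seq (log⁺ (fromℕℝ (suc m)))
  Facts : ℕ → Set
  Facts n = (fromℕ k ≤ℚ seq C n *ℚ partialExp n (seq P n *ℚ l n) +ℚ 1ℚ)
          × (seq C n ≤ℚ partialExp n (seq (log⁺ C) n) +ℚ 1ℚ)
          × (seq (log⁺ C) n ≤ℚ fromℕ A)
          × (0ℚ ≤ℚ seq P n × seq P n ≤ℚ fromℕ A)
          × 1 < n × q < n
  facts : Eventually Facts
  facts = k≤ 1ℚ 0<1 ∩ proj₂ (exp-log⁺ C 1≤C) 1ℚ 0<1 ∩ logC≤A ∩ P≤A ∩ eventually-> 1 ∩ eventually-> q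
  at : Eventually Facts → k ≤ suc (suc (4 ^ A) * 4 ^ (A * (2 * q)))
  at (n , f) = let k≤ , C≤ , logC≤ , (0≤P , P≤) , 1<n , q<n = f n ≤-refl
                   0≤l = 0≤log⁺ (fromℕℝ (suc m)) n
    in product-bound (suc (4 ^ A)) (4 ^ (A * (2 * q))) k≤ (0≤partialExp n (0≤* 0≤P 0≤l))
         (factor-bound {n} A C≤ (0≤log⁺ C n) logC≤)
         (power-bound {n} A (2 * q) 0≤P P≤ 0≤l (log⁺-upper {suc m} {q} {n} 1≤m m< 1<n q<n))

-- The threshold and its size.

-- `Q` need not be decidable: if there is no least witness, well-founded induction refutes every
-- witness.
¬¬-least : {Q : ℕ → Set} → ∃ Q → ¬ ¬ ∃ (IsLeast Q)
¬¬-least {Q} (m , Qm) none = <-rec (λ m → ¬ Q m)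
  (λ m ih Qm → none (m , Qm , λ j Qj → ≮⇒≥ λ j<m → ih j<m Qj)) m Qm

-- The left side is that of `edge-bound` for `q = 2c(N + 1)`. With `u = cAN` the product is at most
-- `4^(9u+1)`, the outer `suc` costs less than a further factor 4, and `9u + 2 ≤ 11u`.
edge-bound-< : ∀ c′ A N → 1 ≤ A → 1 ≤ N →
  suc (suc (4 ^ A) * 4 ^ (A * (2 * (2 * (suc c′ * suc N))))) < 2 ^ (22 * suc c′ * A * N)
edge-bound-< c′ A N 1≤A 1≤N = begin-strict
  suc (suc (4 ^ A) * 4 ^ (A * (2 * (2 * (c * suc N)))))
    ≤⟨ s≤s (*-mono-≤ 1+4^A≤ (^-monoʳ-≤ 4 exponent≤)) ⟩
  suc (4 ^ suc u * 4 ^ (8 * u))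
    ≡⟨ cong suc (sym (^-distribˡ-+-* 4 (suc u) (8 * u))) ⟩
  suc (4 ^ (suc u + 8 * u))
    ≤⟨ suc≤2* _ (m^n>0 4 (suc u + 8 * u)) ⟩
  2 * 4 ^ (suc u + 8 * u)
    <⟨ *-monoˡ-< (4 ^ (suc u + 8 * u)) {{m^n≢0 4 (suc u + 8 * u)}} {2} {4} (s≤s (s≤s (s≤s z≤n))) ⟩
  4 ^ suc (suc u + 8 * u)
    ≤⟨ ^-monoʳ-≤ 4 final ⟩
  4 ^ (11 * u)
    ≡⟨ trans (^-*-assoc 2 2 (11 * u)) (cong (2 ^_) (reassociate c A N)) ⟩
  2 ^ (22 * c * A * N) ∎
  where
  open ≤-Reasoning
  c = suc c′
  u = c * A * N
  suc≤2* : ∀ x → 1 ≤ x → suc x ≤ 2 * x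
  suc≤2* x 1≤x = ≤-trans (+-monoˡ-≤ x 1≤x) (≤-reflexive (cong (x +_) (sym (+-identityʳ x))))
  1≤u : 1 ≤ u
  1≤u = *-mono-≤ (*-mono-≤ {1} {c} (s≤s z≤n) 1≤A) 1≤N
  A≤u : A ≤ u
  A≤u = ≤-trans (m≤n*m A c) (m≤m*n (c * A) N {{>-nonZero 1≤N}})
  1+4^A≤ : suc (4 ^ A) ≤ 4 ^ suc u
  1+4^A≤ = ≤-trans (suc≤2* (4 ^ A) (m^n>0 4 A)) (*-mono-≤ {2} {4} (s≤s (s≤s z≤n)) (^-monoʳ-≤ 4 A≤u))
  exponent≤ : A * (2 * (2 * (c * suc N))) ≤ 8 * u
  exponent≤ = ≤-trans (*-monoʳ-≤ A (*-monoʳ-≤ 2 (*-monoʳ-≤ 2 (*-monoʳ-≤ c (suc≤2* N 1≤N)))))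
    (≤-reflexive (identity c A N))
    where
    identity : ∀ c A N → A * (2 * (2 * (c * (2 * N)))) ≡ 8 * (c * A * N)
    identity = solve-∀
  final : suc (suc u + 8 * u) ≤ 11 * u
  final = ≤-trans (≤-reflexive (shift u)) (≤-trans (+-monoˡ-≤ (9 * u) (*-monoʳ-≤ 2 1≤u)) (≤-reflexive (collect u)))
    where
    shift : ∀ u → 1 + (1 + u + 8 * u) ≡ 2 * 1 + 9 * u
    shift = solve-∀
    collect : ∀ u → 2 * u + 9 * u ≡ 11 * u
    collect = solve-∀
  reassociate : ∀ c A N → 2 * (11 * (c * A * N)) ≡ 22 * c * A * N
  reassociate = solve-∀

module _ (c′ i : ℕ) where

  private
    c = suc c′
    r = 2 + i
    k = 2 + c′

  -- `352 = 2 * 8 * 22` arises from writing `(4 ^ c) ^ logThreshold` as a power of 2; the factor `A`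
  -- is split off because it depends on `P` and `C`.
  exponent : ℕ
  exponent = 352 * (suc c′ * suc c′) * (2 + i)

  1≤8*exponent : 1 ≤ 8 * exponent
  1≤8*exponent = *-mono-≤ {1} {8} {1} {exponent} (s≤s z≤n)
    (*-mono-≤ {1} {352 * (c * c)} {1} {r} (*-mono-≤ {1} {352} {1} {c * c} (s≤s z≤n) (s≤s z≤n)) (s≤s z≤n))

  2^exponent : ∀ A → 2 ^ (exponent * A) ≡ (4 ^ c) ^ logThreshold c′ A i
  2^exponent A = trans (cong (2 ^_) (identity c A r))
    (trans (sym (^-*-assoc 2 2 (c * (8 * (22 * c * A) * r)))) (sym (^-*-assoc 4 c (8 * (22 * c * A) * r))))
    where
    identity : ∀ c A r → 352 * (c * c) * r * A ≡ 2 * (c * (8 * (22 * c * A) * r))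
    identity = solve-∀

  module _ (P C : ℝ) (2≤P : fromℕℝ 2 ≤ℝ P) (2≤C : fromℕℝ 2 ≤ℝ C) where

    private
      x : ℝ
      x = P +ℝ log⁺ C

      1≤P : Eventually λ n → 1ℚ ≤ℚ seq P n
      1≤P = 1≤eventually {1} P 2≤P 1ℚ 0<1 ℚ.≤-refl

      1≤x : Eventually λ n → 1ℚ ≤ℚ seq x n
      1≤x = proj₁ 1≤P , λ n h → ℚ.≤-trans (proj₂ 1≤P n h) (p≤p+q (0≤log⁺ C n))

      1≤C : fromℕℝ 1 ≤ℝ C
      1≤C ε 0<ε = proj₁ (2≤C ε 0<ε) , λ n h → ℚ.≤-trans (fromℕ-mono {1} {2} (s≤s z≤n)) (proj₂ (2≤C ε 0<ε) n h)

      A : ℕ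
      A = proj₁ (nat-upper x 1≤x)

      x≤A≤4x : Eventually λ n → 1ℚ ≤ℚ seq x n × seq x n ≤ℚ fromℕ A × fromℕ A ≤ℚ fromℕ 4 *ℚ seq x n
      x≤A≤4x = 1≤x ∩ proj₂ (nat-upper x 1≤x)

      1≤A : 1 ≤ A
      1≤A = let N , h = x≤A≤4x ; 1≤xₙ , xₙ≤A , _ = h N ≤-refl in
        fromℕ-cancel-≤ {1} {A} (ℚ.≤-trans 1≤xₙ xₙ≤A)

      P≤A : Eventually λ n → 0ℚ ≤ℚ seq P n × seq P n ≤ℚ fromℕ A
      P≤A = proj₁ (1≤P ∩ x≤A≤4x) , λ n h → let 1≤Pₙ , _ , xₙ≤A , _ = proj₂ (1≤P ∩ x≤A≤4x) n h in
        ℚ.≤-trans 0≤1 1≤Pₙ , ℚ.≤-trans (p≤p+q (0≤log⁺ C n)) xₙ≤A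

      logC≤A : Eventually λ n → seq (log⁺ C) n ≤ℚ fromℕ A
      logC≤A = proj₁ (1≤P ∩ x≤A≤4x) , λ n h → let 1≤Pₙ , _ , xₙ≤A , _ = proj₂ (1≤P ∩ x≤A≤4x) n h in
        ℚ.≤-trans (q≤p+q (ℚ.≤-trans 0≤1 1≤Pₙ)) xₙ≤A

    threshold : ℕ
    threshold = 2 ^ (exponent * A)

    isThreshold : IsThreshold r k P C threshold
    isThreshold G χ≥ e≤ = few-edges⇒high-girth-subgraph c′ A i 1≤A G N L≤N
        (subst (_≤ χ G) (^-*-assoc 4 c N) b^N≤χ)
        (≤-<-trans (edge-bound P C A 1≤C P≤A logC≤A {e G} {χ G} {2 * (c * suc N)} 1≤χ χ<2^ e≤)
          (edge-bound-< c′ A N 1≤A (≤-trans 1≤L L≤N)))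
      where
      1≤χ : 1 ≤ χ G
      1≤χ = ≤-trans (m^n>0 2 (exponent * A)) χ≥
      2≤4^c : 2 ≤ 4 ^ c
      2≤4^c = *-mono-≤ {2} {4} (s≤s (s≤s z≤n)) (m^n>0 4 c′)
      -- `N` is read off from `χ G` and not from the threshold, because the permitted number of
      -- edges grows with `χ G`.
      log-χ = floor-log (4 ^ c) (χ G) 2≤4^c 1≤χ
      N = proj₁ log-χ
      b^N≤χ : (4 ^ c) ^ N ≤ χ G
      b^N≤χ = proj₁ (proj₂ log-χ)
      χ< : χ G < (4 ^ c) ^ suc N
      χ< = proj₂ (proj₂ log-χ)
      χ<2^ : χ G < 2 ^ (2 * (c * suc N))
      χ<2^ = subst (χ G <_) (trans (^-*-assoc 4 c (suc N)) (^-*-assoc 2 2 (c * suc N))) χ<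
      1≤L : 1 ≤ logThreshold c′ A i
      1≤L = *-mono-≤ (*-mono-≤ {1} {8} (s≤s z≤n) (*-mono-≤ {1} {22 * c} (s≤s z≤n) 1≤A)) (s≤s z≤n)
      L≤N : logThreshold c′ A i ≤ N
      -- A smaller `N` would give `χ G < (4^c)^(N+1)`, which is at most the threshold.
      L≤N = ≮⇒≥ λ N< → <⇒≱ χ< (≤-trans
        (^-monoʳ-≤ (4 ^ c) {{>-nonZero (m^n>0 4 c)}} N<) (subst (_≤ χ G) (2^exponent A) χ≥))

    -- With `ℓ` the exponent, `2^(ℓA) ≤ exp (2ℓA) ≤ exp (8ℓx) ≤ exp (8ℓx²)`, by `A ≤ 4x` and `1 ≤
    -- x`. This is the source of the factor 8 in `B`.
    threshold-≤ : fromℕℝ threshold ≤ℝ exp (fromℕℝ (8 * exponent) *ℝ (x *ℝ x))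
    threshold-≤ ε 0<ε = proj₁ facts , λ n h → ℚ.≤-trans (at (proj₂ facts n h)) (p≤p+q (ℚ.<⇒≤ 0<ε))
      where
      facts : Eventually λ n → (1ℚ ≤ℚ seq x n × seq x n ≤ℚ fromℕ A × fromℕ A ≤ℚ fromℕ 4 *ℚ seq x n) × exponent * A < n
      facts = x≤A≤4x ∩ eventually-> (exponent * A)
      square : ∀ ℓ A {q} → 1ℚ ≤ℚ q → fromℕ A ≤ℚ fromℕ 4 *ℚ q → fromℕ (2 * (ℓ * A)) ≤ℚ fromℕ (8 * ℓ) *ℚ (q *ℚ q)
      square ℓ A {q} 1≤q A≤4q = begin
        fromℕ (2 * (ℓ * A))                    ≡⟨ trans (cong fromℕ (sym (*-assoc 2 ℓ A))) (fromℕ-* (2 * ℓ) A) ⟩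
        fromℕ (2 * ℓ) *ℚ fromℕ A               ≤⟨ *-≤ˡ (fromℕ (2 * ℓ)) (0≤fromℕ (2 * ℓ)) A≤4q ⟩
        fromℕ (2 * ℓ) *ℚ (fromℕ 4 *ℚ q)        ≡⟨ sym (ℚ.*-assoc (fromℕ (2 * ℓ)) (fromℕ 4) q) ⟩
        fromℕ (2 * ℓ) *ℚ fromℕ 4 *ℚ q          ≡⟨ cong (_*ℚ q) (trans (sym (fromℕ-* (2 * ℓ) 4)) (cong fromℕ (identity ℓ))) ⟩
        fromℕ (8 * ℓ) *ℚ q                     ≡⟨ cong (fromℕ (8 * ℓ) *ℚ_) (sym (ℚ.*-identityʳ q)) ⟩
        fromℕ (8 * ℓ) *ℚ (q *ℚ 1ℚ)             ≤⟨ *-≤ˡ (fromℕ (8 * ℓ)) (0≤fromℕ (8 * ℓ)) (*-≤ˡ q (ℚ.≤-trans 0≤1 1≤q) 1≤q) ⟩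
        fromℕ (8 * ℓ) *ℚ (q *ℚ q)              ∎
        where
        open ℚ.≤-Reasoning
        identity : ∀ ℓ → 2 * ℓ * 4 ≡ 8 * ℓ
        identity = solve-∀
      at : ∀ {n} → (1ℚ ≤ℚ seq x n × seq x n ≤ℚ fromℕ A × fromℕ A ≤ℚ fromℕ 4 *ℚ seq x n) × exponent * A < n →
           fromℕ threshold ≤ℚ partialExp n (fromℕ (8 * exponent) *ℚ (seq x n *ℚ seq x n))
      at {n} ((1≤xₙ , _ , A≤4x) , <n) = 2^-≤-partialExp {n} {exponent * A} <n (square exponent A 1≤xₙ A≤4x)

theorem10p40 : (r k : ℕ) → 4 ≤ r → 2 ≤ k →
    Σ ℝ λ B → fromℕℝ 0 <ℝ B ×
    ((P C : ℝ) → fromℕℝ 2 ≤ℝ P → fromℕℝ 2 ≤ℝ C →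
    ¬ ¬ (Σ ℕ λ M → IsM r k P C M ×
    fromℕℝ M ≤ℝ exp (B *ℝ ((P +ℝ log⁺ C) *ℝ (P +ℝ log⁺ C)))))
theorem10p40 (suc zero) _ (s≤s ()) _
theorem10p40 (suc (suc _)) (suc zero) _ (s≤s ())
theorem10p40 (suc (suc i)) (suc (suc c′)) _ _ =
  fromℕℝ (8 * exponent c′ i) , (1ℚ , 0<1 , 0 , λ _ _ → fromℕ-mono {1} {8 * exponent c′ i} (1≤8*exponent c′ i)) ,
  λ P C 2≤P 2≤C no-M →
    let M₀ = threshold c′ i P C 2≤P 2≤C
        isT = isThreshold c′ i P C 2≤P 2≤C in
    -- The least threshold is at most the explicit one and inherits its bound.
    ¬¬-least {IsThreshold (2 + i) (2 + c′) P C} (M₀ , isT) λ (M , isM) → no-M (M , isM , λ ε 0<ε →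
      let N , bound = threshold-≤ c′ i P C 2≤P 2≤C ε 0<ε in
      N , λ n h → ℚ.≤-trans (fromℕ-mono {M} {M₀} (proj₂ isM M₀ isT)) (bound n h))
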